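{- Let $\mathbf{A}$ be a finite metric space and let $p,q$ be partial isometries of $\mathbf{A}$ with $\mathrm{Per}(p)=\mathrm{Fix}(p)$, $\mathrm{Per}(q)=\mathrm{Fix}(q)$ and $\mathrm{Fix}(p)\cap\mathrm{Fix}(q)\neq\emptyset$. Then there exist a finite metric space $(\mathbf{B},d)$ containing $\mathbf{A}$ as a metric subspace, partial isometries $\bar p\supseteq p$ and $\bar q\supseteq q$ of $\mathbf{B}$, and a reduced word $w=t^Kv\in F(s,t)$ with $K\neq0$ (the product $t^Kv$ reduced) such that: (i) $\mathrm{Per}(\bar p)=\mathrm{Per}(p)$ and $\mathrm{Per}(\bar q)=\mathrm{Per}(q)$; (ii) $w(\bar p,\bar q)(a)$ is defined for every $a\in\mathbf{A}$, and $\mathrm{dom}(\bar p)\cup w(\bar p,\bar q)(\mathbf{A})$ is the free amalgam of $\mathrm{dom}(\bar p)$ and $w(\bar p,\bar q)(\mathbf{A})$ over $\mathrm{Fix}(p)\cap\mathrm{Fix}(q)$, i.e. for all $x\in w(\bar p,\bar q)(\mathbf{A})$ and $y\in\mathrm{dom}(\bar p)$, $$d(x,y)=\min\{d(x,z)+d(z,y): z\in\mathrm{Fix}(p)\cap\mathrm{Fix}(q)\}.$$ Moreover, all distances in $\mathbf{B}$ lie in the additive semigroup generated by the distances in $\mathbf{A}$; in particular $\mathrm{den}(\mathrm{dom}(\bar p)\cup\mathbf{A})=\mathrm{den}(\mathbf{A})=\mathrm{den}(\mathrm{dom}(\bar q)\cup\mathbf{A})$.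
   Context: A partial isometry of a metric space $\mathbf{C}$ is an isometry $p$ between finite subsets $\mathrm{dom}(p),\mathrm{ran}(p)\subseteq\mathbf{C}$; $\bar p\supseteq p$ means $\bar p$ extends $p$. $\mathrm{Fix}(p)=\{x\in\mathrm{dom}(p):p(x)=x\}$. A point $x\in\mathrm{dom}(p)$ is periodic if there is $n>0$ with $x,p(x),\dots,p^n(x)\in\mathrm{dom}(p)$ (all defined) and $p^n(x)=x$; $\mathrm{Per}(p)$ is the set of periodic points. For a finite metric space with at least two points, $\mathrm{den}$ is the minimal distance between two distinct points. $F(s,t)$ is the free group on $s,t$; for a reduced word $w=t^{n_k}s^{m_k}\cdots t^{n_1}s^{m_1}$ and partial maps $p,q$, $w(p,q)(c)=q^{n_k}p^{m_k}\cdots q^{n_1}p^{m_1}(c)$ whenever the right-hand side is defined (the rightmost letter acts first). -}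

module Defs where

open import Data.Fin.Base using (Fin)
open import Data.Integer.Base using (ℤ; sign) renaming (∣_∣ to ∣_∣ℤ)
open import Data.List.Base using (List; []; _∷_; replicate)
open import Data.List.Relation.Unary.Linked using (Linked)
open import Data.Maybe.Base using (Maybe; just; _>>=_)
open import Data.Nat.Base as ℕ using (ℕ; zero; suc; _⊔_)
import Data.Nat.Properties as ℕ
open import Data.Product.Base using (∃-syntax; _×_; _,_)
open import Data.Rational.Base as ℚ using (ℚ; 0ℚ; ½)
import Data.Rational.Properties as ℚ
open import Data.Rational.Solver using (module +-*-Solver)
open import Data.Sign.Base using (Sign; opposite)
open import Function.Bundles using (_↔_)
open import Level using (0ℓ)
open import Relation.Binary.PropositionalEquality using (_≡_; _≢_; refl; cong)
open import Relation.Unary using (Pred)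

IsCauchy : (ℕ → ℚ) → Set
IsCauchy s = ∀ ε → 0ℚ ℚ.< ε →
  ∃[ N ] (∀ m n → N ℕ.≤ m → N ℕ.≤ n → ℚ.∣ s m ℚ.- s n ∣ ℚ.< ε)

-- A real is a Cauchy sequence of rationals; equality of reals is _≈_.
record ℝ : Set where
  constructor mkℝ
  field
    seq    : ℕ → ℚ
    cauchy : IsCauchy seq

open ℝ public

infix  4 _≈_ _≤_
infixl 6 _+_

_≈_ : ℝ → ℝ → Set
x ≈ y = ∀ ε → 0ℚ ℚ.< ε →
  ∃[ N ] (∀ n → N ℕ.≤ n → ℚ.∣ seq x n ℚ.- seq y n ∣ ℚ.< ε)

_≤_ : ℝ → ℝ → Set
x ≤ y = ∀ ε → 0ℚ ℚ.< ε →
  ∃[ N ] (∀ n → N ℕ.≤ n → seq x n ℚ.< seq y n ℚ.+ ε)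

0ℝ : ℝ
0ℝ = mkℝ (λ _ → 0ℚ) (λ ε 0<ε → 0 , λ _ _ _ _ → 0<ε)

private
  half-pos : ∀ ε → 0ℚ ℚ.< ε → 0ℚ ℚ.< ½ ℚ.* ε
  half-pos ε 0<ε = ℚ.*-monoʳ-<-pos ½ 0<ε

  halves : ∀ ε → ½ ℚ.* ε ℚ.+ ½ ℚ.* ε ≡ ε
  halves = solve 1 (λ e → con ½ :* e :+ con ½ :* e := e) refl
    where open +-*-Solver

  interchange : ∀ a b c d →
    (a ℚ.+ b) ℚ.- (c ℚ.+ d) ≡ (a ℚ.- c) ℚ.+ (b ℚ.- d)
  interchange = solve 4 (λ a b c d →
    (a :+ b) :- (c :+ d) := (a :- c) :+ (b :- d)) refl
    where open +-*-Solver

_+_ : ℝ → ℝ → ℝ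
x + y = mkℝ (λ n → seq x n ℚ.+ seq y n) sum-cauchy
  where
  sum-cauchy : IsCauchy (λ n → seq x n ℚ.+ seq y n)
  sum-cauchy ε 0<ε
    with M , x-close ← cauchy x (½ ℚ.* ε) (half-pos ε 0<ε)
       | N , y-close ← cauchy y (½ ℚ.* ε) (half-pos ε 0<ε)
    = M ⊔ N , λ m n M⊔N≤m M⊔N≤n → begin-strict
      ℚ.∣ (seq x m ℚ.+ seq y m) ℚ.- (seq x n ℚ.+ seq y n) ∣
        ≡⟨ cong ℚ.∣_∣ (interchange (seq x m) (seq y m) (seq x n) (seq y n)) ⟩
      ℚ.∣ (seq x m ℚ.- seq x n) ℚ.+ (seq y m ℚ.- seq y n) ∣
        ≤⟨ ℚ.∣p+q∣≤∣p∣+∣q∣ (seq x m ℚ.- seq x n) (seq y m ℚ.- seq y n) ⟩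
      ℚ.∣ seq x m ℚ.- seq x n ∣ ℚ.+ ℚ.∣ seq y m ℚ.- seq y n ∣
        <⟨ ℚ.+-mono-<
             (x-close m n (ℕ.m⊔n≤o⇒m≤o M N M⊔N≤m) (ℕ.m⊔n≤o⇒m≤o M N M⊔N≤n))
             (y-close m n (ℕ.m⊔n≤o⇒n≤o M N M⊔N≤m) (ℕ.m⊔n≤o⇒n≤o M N M⊔N≤n)) ⟩
      ½ ℚ.* ε ℚ.+ ½ ℚ.* ε
        ≡⟨ halves ε ⟩
      ε ∎
    where open ℚ.≤-Reasoning

IsMinimum : Pred ℝ 0ℓ → ℝ → Set
IsMinimum S r = (∃[ s ] (S s × r ≈ s)) × (∀ s → S s → r ≤ s)

-- Closed under _≈_.
data AdditiveSemigroup (S : Pred ℝ 0ℓ) : Pred ℝ 0ℓ where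
  generator : ∀ {r s} → S s → r ≈ s → AdditiveSemigroup S r
  sum       : ∀ {r s t} → AdditiveSemigroup S s → AdditiveSemigroup S t →
              r ≈ s + t → AdditiveSemigroup S r

record FiniteMetricSpace : Set₁ where
  field
    Carrier    : Set
    size       : ℕ
    finite     : Carrier ↔ Fin size
    d          : Carrier → Carrier → ℝ
    d-nonNeg   : ∀ x y → 0ℝ ≤ d x y
    d-refl     : ∀ x → d x x ≈ 0ℝ
    d-separate : ∀ {x y} → d x y ≈ 0ℝ → x ≡ y
    d-sym      : ∀ x y → d x y ≈ d y x
    d-triangle : ∀ x y z → d x z ≤ d x y + d y z

open FiniteMetricSpace public using (Carrier)
open FiniteMetricSpace using (d)

Distances : FiniteMetricSpace → Pred ℝ 0ℓ
Distances M r = ∃[ x ] ∃[ y ] r ≡ d M x y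

-- IsDen M S r : the subspace S of M has at least two points and den(S) = r.
IsDen : (M : FiniteMetricSpace) → Pred (Carrier M) 0ℓ → ℝ → Set
IsDen M S = IsMinimum λ r →
  ∃[ x ] ∃[ y ] (S x × S y × x ≢ y × r ≡ d M x y)

IsFreeAmalgamOver : (M : FiniteMetricSpace) (Z Y X : Pred (Carrier M) 0ℓ) → Set
IsFreeAmalgamOver M Z Y X = ∀ x y → X x → Y y →
  IsMinimum (λ r → ∃[ z ] (Z z × r ≡ d M x z + d M z y)) (d M x y)

record _↪_ (A B : FiniteMetricSpace) : Set where
  field
    to        : Carrier A → Carrier B
    isometric : ∀ x y → d B (to x) (to y) ≈ d A x y

open _↪_ public using (to)

image : {A B : Set} → (A → B) → Pred A 0ℓ → Pred B 0ℓ
image f P y = ∃[ x ] (P x × f x ≡ y)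

-- dom(p) is the set where fun is not nothing; injectivity follows from isometric.
record PartialIsometry (M : FiniteMetricSpace) : Set where
  field
    fun       : Carrier M → Maybe (Carrier M)
    isometric : ∀ {x y x′ y′} → fun x ≡ just x′ → fun y ≡ just y′ →
                d M x′ y′ ≈ d M x y

open PartialIsometry using (fun)

module _ {M : FiniteMetricSpace} (p : PartialIsometry M) where

  Dom : Pred (Carrier M) 0ℓ
  Dom x = ∃[ y ] fun p x ≡ just y

  iterate : ℕ → Carrier M → Maybe (Carrier M)
  iterate zero    x = just x
  iterate (suc n) x = iterate n x >>= fun p

  Fix : Pred (Carrier M) 0ℓ
  Fix x = fun p x ≡ just x

  Per : Pred (Carrier M) 0ℓ
  Per x = ∃[ n ] (0 ℕ.< n
        × (∀ i → i ℕ.≤ n → ∃[ y ] (iterate i x ≡ just y × Dom y))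
        × iterate n x ≡ just x)

Extends : {A B : FiniteMetricSpace} → A ↪ B →
          PartialIsometry B → PartialIsometry A → Set
Extends ι p̄ p = ∀ x y → fun p x ≡ just y → fun p̄ (to ι x) ≡ just (to ι y)

data Generator : Set where
  s t : Generator

Letter : Set
Letter = Generator × Sign

Word : Set
Word = List Letter

inverse : Letter → Letter
inverse (g , σ) = g , opposite σ

-- Elements of the free group F(s,t) are the reduced words.
Reduced : Word → Set
Reduced = Linked (λ k l → l ≢ inverse k)

infix 8 _^_

_^_ : Generator → ℤ → Word
g ^ k = replicate ∣ k ∣ℤ (g , sign k)

module _ {M : FiniteMetricSpace} (p q : PartialIsometry M) where

  assign : Generator → PartialIsometry M
  assign s = p
  assign t = q

  LetterMaps : Letter → Carrier M → Carrier M → Set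
  LetterMaps (g , Sign.+) x y = fun (assign g) x ≡ just y
  LetterMaps (g , Sign.-) x y = fun (assign g) y ≡ just x

  -- Maps w x y : w(p,q)(x) is defined and equal to y.  The head of the list is
  -- the leftmost letter, which acts last.
  data Maps : Word → Carrier M → Carrier M → Set where
    []  : ∀ {x} → Maps [] x x
    _∷_ : ∀ {l w x y z} → LetterMaps l y z → Maps w x y → Maps (l ∷ w) x z

  WordImage : Word → Pred (Carrier M) 0ℓ → Pred (Carrier M) 0ℓ
  WordImage w P y = ∃[ x ] (P x × Maps w x y)

{-# OPTIONS --safe #-}

-- A partial isometry f undefined at x is extended to x by one new point f(x) with
-- d(f(x), y) = min { d(x, u) + d(f(u), y) : u ∈ dom f }.  The new point lies outside the
-- domain, so no periodic points appear, and new distances are sums of old ones.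
--
-- However often this is repeated, for y in the original space S and f(x) = x′ the distance
-- d(x′, y) is still at least d(x, u) + d(f(u), y) for some u ∈ dom f inside S.  Running a
-- positive word backwards therefore yields a path in S whose jumps are either trivial
-- or at least den(S) long.  If a block such as tᴺ sᴺ is followed without nontrivial jump,
-- with N ≥ |S|, the pigeonhole principle produces a point fixed by both s and t;
-- otherwise every block costs den(S).  By the Archimedean property a high power of the
-- block leaves the path through a fixed point as the shortest one.
--
-- Applied to tᴺ sᴺ this puts v(A) in free position with A over Fix(p) ∩ Fix(q).  A final
-- power of t, extending only q, frees the result from everything constructed so far, in
-- particular from dom(p̄), over Fix(q) ⊆ A, and the two estimates combine.
module Submission where

open import Defs
open import Axiom.ExcludedMiddle using (ExcludedMiddle)
open import Data.Fin.Base using (Fin; zero; suc; toℕ)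
import Data.Fin.Properties as Fin
open import Data.Integer.Base as ℤ using (ℤ; 0ℤ)
import Data.Integer.Properties as ℤ
open import Data.List.Base using (List; []; _∷_; _++_; concat; map; replicate)
open import Data.List.Properties using (map-++; map-replicate)
open import Data.List.Relation.Unary.All using (All; []; _∷_; universal)
open import Data.List.Relation.Unary.All.Properties using (replicate⁺)
open import Data.List.Relation.Unary.Linked using ([]; [-]; _∷_)
open import Data.Maybe.Base using (Maybe; just; nothing; maybe; _>>=_)
open import Data.Maybe.Properties using (just-injective)
open import Data.Nat.Base as ℕ using (ℕ; zero; suc; _⊔_)
import Data.Nat.Properties as ℕ
open import Data.Product.Base using (Σ-syntax; ∃-syntax; _×_; _,_; proj₁; proj₂; uncurry)
open import Data.Product.Function.NonDependent.Propositional using (_×-↔_)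
open import Data.Rational.Base as ℚ using (ℚ; 0ℚ; 1ℚ; ½; mkℚ)
import Data.Rational.Properties as ℚ
open import Data.Rational.Solver using (module +-*-Solver)
import Data.Rational.Unnormalised.Base as ℚᵘ
import Data.Rational.Unnormalised.Properties as ℚᵘ
open import Data.Sign.Base using (Sign)
open import Data.Sum.Base using (_⊎_; inj₁; inj₂)
open import Data.Unit.Base using (⊤; tt)
open import Function.Base using (_∘_)
open import Function.Bundles using (_↔_; Injection; Inverse; mk↔ₛ′)
open import Function.Properties.Inverse using (↔-sym; ↔-trans; ↔⇒↣)
open import Level using (0ℓ)
open import Relation.Binary.PropositionalEquality using (_≡_; _≢_; refl; sym; trans; cong; cong₂; subst)
import Relation.Binary.Reasoning.Base.Single
open import Relation.Nullary.Decidable.Core using (Dec; yes; no)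
open import Relation.Nullary.Negation.Core using (¬_; contradiction)
open import Relation.Unary using (Pred; U; _⊆_; _∩_; _∪_; _≐_; Satisfiable)
open FiniteMetricSpace using (d)
open PartialIsometry using (fun)

-- Order and addition of Cauchy reals

opaque
  half-pos : ∀ {ε} → 0ℚ ℚ.< ε → 0ℚ ℚ.< ½ ℚ.* ε
  half-pos 0<ε = ℚ.*-monoʳ-<-pos ½ 0<ε

  halves : ∀ ε → ½ ℚ.* ε ℚ.+ ½ ℚ.* ε ≡ ε
  halves = solve 1 (λ e → con ½ :* e :+ con ½ :* e := e) refl
    where open +-*-Solver

  p-q+q≡p : ∀ p q → p ℚ.- q ℚ.+ q ≡ p
  p-q+q≡p = solve 2 (λ p q → p :- q :+ q := p) refl
    where open +-*-Solver

  p+q-q≡p : ∀ p q → p ℚ.+ q ℚ.- q ≡ p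
  p+q-q≡p = solve 2 (λ p q → p :+ q :- q := p) refl
    where open +-*-Solver

  p≤∣p∣ : ∀ p → p ℚ.≤ ℚ.∣ p ∣
  p≤∣p∣ (mkℚ (ℤ.+ _) _ _)    = ℚ.≤-refl
  p≤∣p∣ (mkℚ ℤ.-[1+ _ ] _ _) = ℚ.*≤* ℤ.-≤+

  ∣-∣<⇒<+ : ∀ p q {ε} → ℚ.∣ p ℚ.- q ∣ ℚ.< ε → p ℚ.< q ℚ.+ ε
  ∣-∣<⇒<+ p q {ε} close = begin-strict
    p                ≡⟨ p-q+q≡p p q ⟨
    p ℚ.- q ℚ.+ q    ≤⟨ ℚ.+-monoˡ-≤ q (p≤∣p∣ (p ℚ.- q)) ⟩
    ℚ.∣ p ℚ.- q ∣ ℚ.+ q <⟨ ℚ.+-monoˡ-< q close ⟩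
    ε ℚ.+ q          ≡⟨ ℚ.+-comm ε q ⟩
    q ℚ.+ ε          ∎
    where open ℚ.≤-Reasoning

  ∣-∣-sym : ∀ p q → ℚ.∣ p ℚ.- q ∣ ≡ ℚ.∣ q ℚ.- p ∣
  ∣-∣-sym p q = trans (cong ℚ.∣_∣ (flip p q)) (ℚ.∣-p∣≡∣p∣ (q ℚ.- p))
    where
    open +-*-Solver
    flip : ∀ p q → p ℚ.- q ≡ ℚ.- (q ℚ.- p)
    flip = solve 2 (λ p q → p :- q := :- (q :- p)) refl

  <+⇒-< : ∀ {p q ε} → p ℚ.< q ℚ.+ ε → p ℚ.- q ℚ.< ε
  <+⇒-< {p} {q} {ε} p<q+ε = begin-strict
    p ℚ.- q         <⟨ ℚ.+-monoˡ-< (ℚ.- q) p<q+ε ⟩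
    q ℚ.+ ε ℚ.- q   ≡⟨ cong (ℚ._- q) (ℚ.+-comm q ε) ⟩
    ε ℚ.+ q ℚ.- q   ≡⟨ p+q-q≡p ε q ⟩
    ε               ∎
    where open ℚ.≤-Reasoning

  <+⇒∣-∣< : ∀ {p q ε} → p ℚ.< q ℚ.+ ε → q ℚ.< p ℚ.+ ε → ℚ.∣ p ℚ.- q ∣ ℚ.< ε
  <+⇒∣-∣< {p} {q} p<q+ε q<p+ε with ℚ.∣p∣≡p∨∣p∣≡-p (p ℚ.- q) | ℚ.∣p∣≡p∨∣p∣≡-p (q ℚ.- p)
  ... | inj₁ eq | _       = subst (ℚ._< _) (sym eq) (<+⇒-< p<q+ε)
  ... | inj₂ _  | inj₁ eq = subst (ℚ._< _) (sym (trans (∣-∣-sym p q) eq)) (<+⇒-< q<p+ε)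
  ... | inj₂ eq | inj₂ _  = subst (ℚ._< _) (sym (trans eq (flip p q))) (<+⇒-< q<p+ε)
    where
    open +-*-Solver
    flip : ∀ p q → ℚ.- (p ℚ.- q) ≡ q ℚ.- p
    flip = solve 2 (λ p q → :- (p :- q) := q :- p) refl

  ≈⇒≤ : ∀ {x y} → x ≈ y → x ≤ y
  ≈⇒≤ {x} {y} x≈y ε 0<ε with N , close ← x≈y ε 0<ε =
    N , λ n N≤n → ∣-∣<⇒<+ (seq x n) (seq y n) (close n N≤n)

  ≈-sym : ∀ {x y} → x ≈ y → y ≈ x
  ≈-sym {x} {y} x≈y ε 0<ε with N , close ← x≈y ε 0<ε =
    N , λ n N≤n → subst (ℚ._< ε) (∣-∣-sym (seq x n) (seq y n)) (close n N≤n)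

  ≤-antisym : ∀ {x y} → x ≤ y → y ≤ x → x ≈ y
  ≤-antisym x≤y y≤x ε 0<ε
    with M , x<y ← x≤y ε 0<ε | N , y<x ← y≤x ε 0<ε =
    M ⊔ N , λ n M⊔N≤n → <+⇒∣-∣< (x<y n (ℕ.m⊔n≤o⇒m≤o M N M⊔N≤n))
                                (y<x n (ℕ.m⊔n≤o⇒n≤o M N M⊔N≤n))

-- A record, unlike the Π-type _≤_, lets x and y be inferred from a proof.
infix 4 _≼_
record _≼_ (x y : ℝ) : Set where
  constructor wrap
  field unwrap : x ≤ y
open _≼_

opaque
  ≈⇒≼ : ∀ {x y} → x ≈ y → x ≼ y
  ≈⇒≼ {x} {y} x≈y = wrap (≈⇒≤ {x} {y} x≈y)

  ≈⇒≽ : ∀ {x y} → x ≈ y → y ≼ x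
  ≈⇒≽ {x} {y} x≈y = ≈⇒≼ (≈-sym {x} {y} x≈y)

  ≼-antisym : ∀ {x y} → x ≼ y → y ≼ x → x ≈ y
  ≼-antisym {x} {y} (wrap x≤y) (wrap y≤x) = ≤-antisym {x} {y} x≤y y≤x

  eventually-≤⇒≼ : ∀ {x y} N → (∀ n → N ℕ.≤ n → seq x n ℚ.≤ seq y n) → x ≼ y
  eventually-≤⇒≼ {x} {y} N x≤y = wrap λ ε 0<ε → N , λ n N≤n → begin-strict
    seq x n          ≤⟨ x≤y n N≤n ⟩
    seq y n          ≡⟨ ℚ.+-identityʳ (seq y n) ⟨
    seq y n ℚ.+ 0ℚ   <⟨ ℚ.+-monoʳ-< (seq y n) 0<ε ⟩
    seq y n ℚ.+ ε    ∎
    where open ℚ.≤-Reasoning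

  pointwise : ∀ {x y} → (∀ n → seq x n ≡ seq y n) → x ≼ y
  pointwise {x} {y} x≡y = eventually-≤⇒≼ {x} {y} 0 λ n _ → ℚ.≤-reflexive (x≡y n)

  ≼-refl : ∀ {x} → x ≼ x
  ≼-refl {x} = pointwise {x} {x} λ _ → refl

  ≼-trans : ∀ {x y z} → x ≼ y → y ≼ z → x ≼ z
  ≼-trans {x} {y} {z} (wrap x≤y) (wrap y≤z) = wrap x≤z
    where
    x≤z : x ≤ z
    x≤z ε 0<ε
      with M , x<y ← x≤y (½ ℚ.* ε) (half-pos 0<ε)
         | N , y<z ← y≤z (½ ℚ.* ε) (half-pos 0<ε)
      = M ⊔ N , λ n M⊔N≤n → begin-strict
        seq x n                              <⟨ x<y n (ℕ.m⊔n≤o⇒m≤o M N M⊔N≤n) ⟩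
        seq y n ℚ.+ ½ ℚ.* ε                  <⟨ ℚ.+-monoˡ-< (½ ℚ.* ε) (y<z n (ℕ.m⊔n≤o⇒n≤o M N M⊔N≤n)) ⟩
        seq z n ℚ.+ ½ ℚ.* ε ℚ.+ ½ ℚ.* ε      ≡⟨ ℚ.+-assoc (seq z n) (½ ℚ.* ε) (½ ℚ.* ε) ⟩
        seq z n ℚ.+ (½ ℚ.* ε ℚ.+ ½ ℚ.* ε)    ≡⟨ cong (seq z n ℚ.+_) (halves ε) ⟩
        seq z n ℚ.+ ε                        ∎
      where open ℚ.≤-Reasoning

-- Addition itself unfolds to a Cauchy sequence, which makes unification diverge.
infixl 6 _⊕_
opaque
  _⊕_ : ℝ → ℝ → ℝ
  _⊕_ = _+_

  seq-⊕ : ∀ x y n → seq (x ⊕ y) n ≡ seq x n ℚ.+ seq y n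
  seq-⊕ x y n = refl

opaque
  +-mono-≼ : ∀ {x y u v} → x ≼ y → u ≼ v → x + u ≼ y + v
  +-mono-≼ {x} {y} {u} {v} (wrap x≤y) (wrap u≤v) = wrap x+u≤y+v
    where
    interchange : ∀ a b c d → (a ℚ.+ b) ℚ.+ (c ℚ.+ d) ≡ (a ℚ.+ c) ℚ.+ (b ℚ.+ d)
    interchange = solve 4 (λ a b c d → (a :+ b) :+ (c :+ d) := (a :+ c) :+ (b :+ d)) refl
      where open +-*-Solver

    x+u≤y+v : x + u ≤ y + v
    x+u≤y+v ε 0<ε
      with M , x<y ← x≤y (½ ℚ.* ε) (half-pos 0<ε)
         | N , u<v ← u≤v (½ ℚ.* ε) (half-pos 0<ε)
      = M ⊔ N , λ n M⊔N≤n → begin-strict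
        seq x n ℚ.+ seq u n                                      <⟨ ℚ.+-mono-< (x<y n (ℕ.m⊔n≤o⇒m≤o M N M⊔N≤n))
                                                                                (u<v n (ℕ.m⊔n≤o⇒n≤o M N M⊔N≤n)) ⟩
        (seq y n ℚ.+ ½ ℚ.* ε) ℚ.+ (seq v n ℚ.+ ½ ℚ.* ε)          ≡⟨ interchange (seq y n) (½ ℚ.* ε) (seq v n) (½ ℚ.* ε) ⟩
        (seq y n ℚ.+ seq v n) ℚ.+ (½ ℚ.* ε ℚ.+ ½ ℚ.* ε)          ≡⟨ cong (seq y n ℚ.+ seq v n ℚ.+_) (halves ε) ⟩
        seq y n ℚ.+ seq v n ℚ.+ ε                                ∎
      where open ℚ.≤-Reasoning

opaque
  unfolding _⊕_

  ⊕-mono-≼ : ∀ {x y u v} → x ≼ y → u ≼ v → x ⊕ u ≼ y ⊕ v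
  ⊕-mono-≼ {x} {y} {u} {v} = +-mono-≼ {x} {y} {u} {v}

  ⊕-comm-≼ : ∀ x y → x ⊕ y ≼ y ⊕ x
  ⊕-comm-≼ x y = pointwise {x ⊕ y} {y ⊕ x} λ n → ℚ.+-comm (seq x n) (seq y n)

  ⊕-assoc-≼ : ∀ x y z → x ⊕ y ⊕ z ≼ x ⊕ (y ⊕ z)
  ⊕-assoc-≼ x y z = pointwise λ n → ℚ.+-assoc (seq x n) (seq y n) (seq z n)

  ⊕-assoc-≽ : ∀ x y z → x ⊕ (y ⊕ z) ≼ x ⊕ y ⊕ z
  ⊕-assoc-≽ x y z = pointwise λ n → sym (ℚ.+-assoc (seq x n) (seq y n) (seq z n))

  ⊕-identityʳ-≼ : ∀ x → x ⊕ 0ℝ ≼ x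
  ⊕-identityʳ-≼ x = pointwise λ n → ℚ.+-identityʳ (seq x n)

  ⊕-identityʳ-≽ : ∀ x → x ≼ x ⊕ 0ℝ
  ⊕-identityʳ-≽ x = pointwise λ n → sym (ℚ.+-identityʳ (seq x n))

opaque
  ⊕-monoˡ-≼ : ∀ {x y} u → x ≼ y → x ⊕ u ≼ y ⊕ u
  ⊕-monoˡ-≼ u x≼y = ⊕-mono-≼ x≼y ≼-refl

  ⊕-monoʳ-≼ : ∀ {x y} u → x ≼ y → u ⊕ x ≼ u ⊕ y
  ⊕-monoʳ-≼ u x≼y = ⊕-mono-≼ ≼-refl x≼y

  x≼x⊕y : ∀ {y} x → 0ℝ ≼ y → x ≼ x ⊕ y
  x≼x⊕y x 0≼y = ≼-trans (⊕-identityʳ-≽ x) (⊕-monoʳ-≼ x 0≼y)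

  x≼y⊕x : ∀ {y} x → 0ℝ ≼ y → x ≼ y ⊕ x
  x≼y⊕x {y} x 0≼y = ≼-trans (x≼x⊕y x 0≼y) (⊕-comm-≼ x y)

-- Natural multiples and the Archimedean property

infixr 7 _·_
_·_ : ℕ → ℝ → ℝ
zero  · x = 0ℝ
suc n · x = x ⊕ n · x

opaque
  ·-monoˡ-≼ : ∀ {m n x} → 0ℝ ≼ x → m ℕ.≤ n → m · x ≼ n · x
  ·-monoˡ-≼ {n = zero}  0≼x ℕ.z≤n = ≼-refl
  ·-monoˡ-≼ {n = suc n} 0≼x ℕ.z≤n =
    ≼-trans (·-monoˡ-≼ {n = n} 0≼x ℕ.z≤n) (x≼y⊕x _ 0≼x)
  ·-monoˡ-≼ 0≼x (ℕ.s≤s m≤n) = ⊕-monoʳ-≼ _ (·-monoˡ-≼ 0≼x m≤n)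

infixr 7 _·ℚ_
_·ℚ_ : ℕ → ℚ → ℚ
zero  ·ℚ p = 0ℚ
suc n ·ℚ p = p ℚ.+ n ·ℚ p

opaque
  ·ℚ-monoʳ-≤ : ∀ n {p q} → p ℚ.≤ q → n ·ℚ p ℚ.≤ n ·ℚ q
  ·ℚ-monoʳ-≤ zero    p≤q = ℚ.≤-refl
  ·ℚ-monoʳ-≤ (suc n) p≤q = ℚ.+-mono-≤ p≤q (·ℚ-monoʳ-≤ n p≤q)

  ·ℚ-distrib : ∀ n p → n ·ℚ p ≡ (n ·ℚ 1ℚ) ℚ.* p
  ·ℚ-distrib zero    p = sym (ℚ.*-zeroˡ p)
  ·ℚ-distrib (suc n) p = trans
    (cong₂ ℚ._+_ (sym (ℚ.*-identityˡ p)) (·ℚ-distrib n p))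
    (sym (ℚ.*-distribʳ-+ p 1ℚ (n ·ℚ 1ℚ)))

  seq-· : ∀ n x k → seq (n · x) k ≡ n ·ℚ seq x k
  seq-· zero    x k = refl
  seq-· (suc n) x k = trans (seq-⊕ x (n · x) k) (cong (seq x k ℚ.+_) (seq-· n x k))

  toℚᵘ-·ℚ : ∀ n → ℚ.toℚᵘ (n ·ℚ 1ℚ) ℚᵘ.≃ ℚᵘ.mkℚᵘ (ℤ.+ n) 0
  toℚᵘ-·ℚ zero    = ℚᵘ.≃-refl
  toℚᵘ-·ℚ (suc n) = ℚᵘ.≃-trans (ℚ.toℚᵘ-homo-+ 1ℚ (n ·ℚ 1ℚ))
    (ℚᵘ.≃-trans (ℚᵘ.+-congʳ (ℚ.toℚᵘ 1ℚ) (toℚᵘ-·ℚ n)) (ℚᵘ.*≡* (cong (λ i → (ℤ.+ 1 ℤ.+ i) ℤ.* ℤ.+ 1) (ℤ.*-identityʳ (ℤ.+ n)))))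

  -- The denominator is at least 1. This gives an explicit natural bound for `·ℚ-archimedean`.
  ≤-∣numerator∣ : ∀ p → p ℚ.≤ ℤ.∣ ℚ.↥ p ∣ ·ℚ 1ℚ
  ≤-∣numerator∣ p = ℚ.toℚᵘ-cancel-≤
    (ℚᵘ.≤-respʳ-≃ (ℚᵘ.≃-sym (toℚᵘ-·ℚ ℤ.∣ ℚ.↥ p ∣)) (numerator-bound p))
    where
    numerator-bound : ∀ p → ℚ.toℚᵘ p ℚᵘ.≤ ℚᵘ.mkℚᵘ (ℤ.+ ℤ.∣ ℚ.↥ p ∣) 0
    numerator-bound (mkℚ (ℤ.+ n) d _)      = ℚᵘ.*≤* (ℤ.*-monoˡ-≤-nonNeg (ℤ.+ n) (ℤ.+≤+ (ℕ.s≤s ℕ.z≤n)))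
    numerator-bound (mkℚ (ℤ.-[1+ n ]) d _) = ℚᵘ.*≤* ℤ.-≤+

  ·ℚ-archimedean : ∀ {ε} → 0ℚ ℚ.< ε → ∀ p → ∃[ n ] p ℚ.≤ n ·ℚ ε
  ·ℚ-archimedean {ε} 0<ε p = n , (begin
    p                        ≡⟨ ℚ.*-identityʳ p ⟨
    p ℚ.* 1ℚ                 ≡⟨ cong (p ℚ.*_) (ℚ.*-inverseˡ ε) ⟨
    p ℚ.* ((ℚ.1/ ε) ℚ.* ε)   ≡⟨ ℚ.*-assoc p (ℚ.1/ ε) ε ⟨
    p ℚ.÷ ε ℚ.* ε            ≤⟨ ℚ.*-monoʳ-≤-nonNeg ε (≤-∣numerator∣ (p ℚ.÷ ε)) ⟩
    (n ·ℚ 1ℚ) ℚ.* ε          ≡⟨ ·ℚ-distrib n ε ⟨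
    n ·ℚ ε                   ∎)
    where
    open ℚ.≤-Reasoning
    instance
      ε-positive : ℚ.Positive ε
      ε-positive = ℚ.positive 0<ε
      ε-nonNegative : ℚ.NonNegative ε
      ε-nonNegative = ℚ.pos⇒nonNeg ε
      ε-nonZero : ℚ.NonZero ε
      ε-nonZero = ℚ.pos⇒nonZero ε
    n : ℕ
    n = ℤ.∣ ℚ.↥ (p ℚ.÷ ε) ∣

module _ (em : ExcludedMiddle 0ℓ) where

  opaque
    -- Excluded middle turns the negated statement into witnesses one quantifier at a time; at the
    -- innermost level the order on ℚ is total.
    ≰⇒frequently-gap : ∀ {x y} → ¬ x ≤ y → ∃[ ε ] (0ℚ ℚ.< ε ×
      (∀ N → ∃[ n ] (N ℕ.≤ n × seq y n ℚ.+ ε ℚ.≤ seq x n)))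
    ≰⇒frequently-gap {x} {y} x≰y
      with em {∃[ ε ] (0ℚ ℚ.< ε × (∀ N → ∃[ n ] (N ℕ.≤ n × seq y n ℚ.+ ε ℚ.≤ seq x n)))}
    ... | yes gap    = gap
    ... | no  no-gap = contradiction x≤y x≰y
      where
      x≤y : x ≤ y
      x≤y ε 0<ε with em {∃[ N ] (∀ n → N ℕ.≤ n → seq x n ℚ.< seq y n ℚ.+ ε)}
      ... | yes eventually    = eventually
      ... | no  no-eventually = contradiction (ε , 0<ε , frequently) no-gap
        where
        frequently : ∀ N → ∃[ n ] (N ℕ.≤ n × seq y n ℚ.+ ε ℚ.≤ seq x n)
        frequently N with em {∃[ n ] (N ℕ.≤ n × seq y n ℚ.+ ε ℚ.≤ seq x n)}
        ... | yes found = found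
        ... | no  none  = contradiction
          (N , λ n N≤n → ℚ.≰⇒> λ y+ε≤x → none (n , N≤n , y+ε≤x)) no-eventually

    -- Beyond the moduli for ε/4 each sequence moves by less than ε/4, so of a gap ε at one late
    -- index k at least ε/2 remains at every later index.
    ≰⇒eventually-gap : ∀ {x y} → ¬ x ≤ y → ∃[ ε ] (0ℚ ℚ.< ε ×
      (∃[ N ] (∀ n → N ℕ.≤ n → seq y n ℚ.+ ε ℚ.≤ seq x n)))
    ≰⇒eventually-gap {x} {y} x≰y
      with ε , 0<ε , gap ← ≰⇒frequently-gap {x} {y} x≰y
      with M , x-close ← cauchy x (½ ℚ.* (½ ℚ.* ε)) (half-pos (half-pos 0<ε))
         | N , y-close ← cauchy y (½ ℚ.* (½ ℚ.* ε)) (half-pos (half-pos 0<ε))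
      with k , M⊔N≤k , y+ε≤x ← gap (M ⊔ N)
      = ½ ℚ.* ε , half-pos 0<ε , M ⊔ N , λ n M⊔N≤n → begin
        seq y n ℚ.+ ½ ℚ.* ε
          ≤⟨ ℚ.+-monoˡ-≤ (½ ℚ.* ε) (ℚ.<⇒≤ (∣-∣<⇒<+ (seq y n) (seq y k) (y-close n k (ℕ.m⊔n≤o⇒n≤o M N M⊔N≤n) (ℕ.m⊔n≤o⇒n≤o M N M⊔N≤k)))) ⟩
        seq y k ℚ.+ η ε ℚ.+ ½ ℚ.* ε
          ≡⟨ regroup (seq y k) ε ⟩
        seq y k ℚ.+ ε ℚ.- η ε
          ≤⟨ ℚ.+-monoˡ-≤ (ℚ.- η ε) y+ε≤x ⟩
        seq x k ℚ.- η ε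
          ≤⟨ ℚ.+-monoˡ-≤ (ℚ.- η ε) (ℚ.<⇒≤ (∣-∣<⇒<+ (seq x k) (seq x n) (x-close k n (ℕ.m⊔n≤o⇒m≤o M N M⊔N≤k) (ℕ.m⊔n≤o⇒m≤o M N M⊔N≤n)))) ⟩
        seq x n ℚ.+ η ε ℚ.- η ε
          ≡⟨ p+q-q≡p (seq x n) (η ε) ⟩
        seq x n ∎
      where
      open ℚ.≤-Reasoning
      η : ℚ → ℚ
      η ε = ½ ℚ.* (½ ℚ.* ε)
      regroup : ∀ p ε → p ℚ.+ η ε ℚ.+ ½ ℚ.* ε ≡ p ℚ.+ ε ℚ.- η ε
      regroup = solve 2 (λ p e → p :+ con ½ :* (con ½ :* e) :+ con ½ :* e
                              := p :+ e :- con ½ :* (con ½ :* e)) refl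
        where open +-*-Solver

    ≼-total : ∀ x y → x ≼ y ⊎ y ≼ x
    ≼-total x y with em {x ≤ y}
    ... | yes x≤y = inj₁ (wrap x≤y)
    ... | no  x≰y = inj₂ (below (≰⇒eventually-gap {x} {y} x≰y))
      where
      open ℚ.≤-Reasoning
      below : ∃[ ε ] (0ℚ ℚ.< ε × (∃[ N ] (∀ n → N ℕ.≤ n → seq y n ℚ.+ ε ℚ.≤ seq x n))) → y ≼ x
      below (ε , 0<ε , N , y+ε≤x) = eventually-≤⇒≼ {y} {x} N λ n N≤n → begin
        seq y n         ≡⟨ ℚ.+-identityʳ (seq y n) ⟨
        seq y n ℚ.+ 0ℚ  ≤⟨ ℚ.+-monoʳ-≤ (seq y n) (ℚ.<⇒≤ 0<ε) ⟩
        seq y n ℚ.+ ε   ≤⟨ y+ε≤x n N≤n ⟩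
        seq x n         ∎

    ⋠0⇒eventually-positive : ∀ {x} → ¬ x ≼ 0ℝ →
      ∃[ ε ] (0ℚ ℚ.< ε × (∃[ N ] (∀ n → N ℕ.≤ n → ε ℚ.≤ seq x n)))
    ⋠0⇒eventually-positive {x} x⋠0 =
      let ε , 0<ε , N , ε≤x = ≰⇒eventually-gap {x} {0ℝ} (λ x≤0 → x⋠0 (wrap x≤0))
      in  ε , 0<ε , N , λ n N≤n → ℚ.≤-trans (ℚ.≤-reflexive (sym (ℚ.+-identityˡ ε))) (ε≤x n N≤n)

    -- From some index on, x stays above a rational ε > 0 and y below its value at N plus 1, so the
    -- rational Archimedean property decides the matter termwise.
    archimedean : ∀ {x} → ¬ x ≼ 0ℝ → ∀ y → ∃[ k ] y ≼ k · x
    archimedean {x} x⋠0 y =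
      bound (⋠0⇒eventually-positive x⋠0) (cauchy y 1ℚ (ℚ.positive⁻¹ 1ℚ))
      where
      open ℚ.≤-Reasoning
      bound : ∃[ ε ] (0ℚ ℚ.< ε × (∃[ N ] (∀ n → N ℕ.≤ n → ε ℚ.≤ seq x n))) →
              ∃[ N ] (∀ m n → N ℕ.≤ m → N ℕ.≤ n → ℚ.∣ seq y m ℚ.- seq y n ∣ ℚ.< 1ℚ) →
              ∃[ k ] y ≼ k · x
      bound (ε , 0<ε , M , ε≤x) (N , y-close)
        with k , y+1≤kε ← ·ℚ-archimedean 0<ε (seq y N ℚ.+ 1ℚ)
        = k , eventually-≤⇒≼ {y} {k · x} (M ⊔ N) λ n M⊔N≤n → begin
          seq y n         ≤⟨ ℚ.<⇒≤ (∣-∣<⇒<+ (seq y n) (seq y N) (y-close n N (ℕ.m⊔n≤o⇒n≤o M N M⊔N≤n) ℕ.≤-refl)) ⟩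
          seq y N ℚ.+ 1ℚ  ≤⟨ y+1≤kε ⟩
          k ·ℚ ε          ≤⟨ ·ℚ-monoʳ-≤ k (ε≤x n (ℕ.m⊔n≤o⇒m≤o M N M⊔N≤n)) ⟩
          k ·ℚ seq x n    ≡⟨ seq-· k x n ⟨
          seq (k · x) n   ∎

-- Finite metric spaces and partial isometries

module ≼-Reasoning = Relation.Binary.Reasoning.Base.Single _≼_ ≼-refl ≼-trans

opaque
  unfolding _⊕_
  ≤-+⇒≼-⊕ : ∀ {x y z} → x ≤ y + z → x ≼ y ⊕ z
  ≤-+⇒≼-⊕ = wrap

  ≼-⊕⇒≤-+ : ∀ {x y z} → x ≼ y ⊕ z → x ≤ y + z
  ≼-⊕⇒≤-+ = _≼_.unwrap

  ≼-⊕⇒≈-+ : ∀ {x y z} → x ≼ y ⊕ z → y ⊕ z ≼ x → x ≈ y + z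
  ≼-⊕⇒≈-+ = ≼-antisym

  ≈-+⇒≼-⊕ : ∀ {x y z} → x ≈ y + z → x ≼ y ⊕ z
  ≈-+⇒≼-⊕ = ≈⇒≼

  ≈-+⇒≽-⊕ : ∀ {x y z} → x ≈ y + z → y ⊕ z ≼ x
  ≈-+⇒≽-⊕ = ≈⇒≽

  ⊕-regroup : ∀ w x y z → w ⊕ ((x ⊕ y) ⊕ z) ≼ (x ⊕ w) ⊕ (y ⊕ z)
  ⊕-regroup w x y z = pointwise λ n →
    solve 4 (λ a b c e → a :+ ((b :+ c) :+ e) := (b :+ a) :+ (c :+ e)) refl
      (seq w n) (seq x n) (seq y n) (seq z n)
    where open +-*-Solver

module _ (M : FiniteMetricSpace) where
  open FiniteMetricSpace M

  0≼d : ∀ x y → 0ℝ ≼ d M x y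
  0≼d x y = wrap (d-nonNeg x y)

  d-refl-≼ : ∀ x → d M x x ≼ 0ℝ
  d-refl-≼ x = ≈⇒≼ (d-refl x)

  d≼0⇒≡ : ∀ {x y} → d M x y ≼ 0ℝ → x ≡ y
  d≼0⇒≡ {x} {y} d≼0 = d-separate (≼-antisym d≼0 (0≼d x y))

  d-sym-≼ : ∀ x y → d M x y ≼ d M y x
  d-sym-≼ x y = ≈⇒≼ (d-sym x y)

  d-triangle-≼ : ∀ x y z → d M x z ≼ d M x y ⊕ d M y z
  d-triangle-≼ x y z = ≤-+⇒≼-⊕ (d-triangle x y z)

module _ {A B : FiniteMetricSpace} (ι : A ↪ B) where

  embed-≼ : ∀ x y → d B (to ι x) (to ι y) ≼ d A x y
  embed-≼ x y = ≈⇒≼ (_↪_.isometric ι x y)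

  embed-≽ : ∀ x y → d A x y ≼ d B (to ι x) (to ι y)
  embed-≽ x y = ≈⇒≽ (_↪_.isometric ι x y)

  embed-injective : ∀ {x y} → to ι x ≡ to ι y → x ≡ y
  embed-injective {x} {y} eq = d≼0⇒≡ A (begin
    d A x y                ∼⟨ embed-≽ x y ⟩
    d B (to ι x) (to ι y)  ≡⟨ cong (d B (to ι x)) eq ⟨
    d B (to ι x) (to ι x)  ∼⟨ d-refl-≼ B (to ι x) ⟩
    0ℝ                     ∎)
    where open ≼-Reasoning

module _ {M : FiniteMetricSpace} (p : PartialIsometry M) where

  isometric-≼ : ∀ {x y x′ y′} → fun p x ≡ just x′ → fun p y ≡ just y′ → d M x′ y′ ≼ d M x y
  isometric-≼ px py = ≈⇒≼ (PartialIsometry.isometric p px py)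

  isometric-≽ : ∀ {x y x′ y′} → fun p x ≡ just x′ → fun p y ≡ just y′ → d M x y ≼ d M x′ y′
  isometric-≽ px py = ≈⇒≽ (PartialIsometry.isometric p px py)

  fun-injective : ∀ {x y z} → fun p x ≡ just z → fun p y ≡ just z → x ≡ y
  fun-injective {z = z} px py = d≼0⇒≡ M (≼-trans (isometric-≽ px py) (d-refl-≼ M z))

  >>=-just : ∀ m {z} → (m >>= fun p) ≡ just z → ∃[ y ] (m ≡ just y × fun p y ≡ just z)
  >>=-just (just y) eq = y , refl , eq

  iterate-split : ∀ m {n l x z} → m ℕ.+ n ≡ l → iterate p l x ≡ just z →
    ∃[ y ] (iterate p n x ≡ just y × iterate p m y ≡ just z)
  iterate-split zero            {z = z} refl eq = z , eq , refl
  iterate-split (suc m) {n} {x = x} refl eq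
    with y , eq₁ , py ← >>=-just (iterate p (m ℕ.+ n) x) eq
    with v , eq₂ , eq₃ ← iterate-split m refl eq₁
    = v , eq₂ , trans (cong (_>>= fun p) eq₃) py

  iterate-injective : ∀ n {x y z} → iterate p n x ≡ just z → iterate p n y ≡ just z → x ≡ y
  iterate-injective zero    refl refl = refl
  iterate-injective (suc n) {x} {y} eq eq′
    with u , eqᵤ , pu ← >>=-just (iterate p n x) eq
       | v , eqᵥ , pv ← >>=-just (iterate p n y) eq′
    with refl ← fun-injective pu pv
    = iterate-injective n eqᵤ eqᵥ

  iterate⇒Dom : ∀ n {x y} → iterate p (suc n) x ≡ just y → Dom p x
  iterate⇒Dom n eq with x′ , px , _ ← iterate-split n (ℕ.+-comm n 1) eq = x′ , px

  loop⇒Per : ∀ n {x} → iterate p (suc n) x ≡ just x → Per p x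
  loop⇒Per n {x} loop = suc n , ℕ.s≤s ℕ.z≤n , orbit , loop
    where
    orbit : ∀ i → i ℕ.≤ suc n → ∃[ y ] (iterate p i x ≡ just y × Dom p y)
    orbit i i≤n with suc n ℕ.∸ i | ℕ.m∸n+n≡m i≤n
    -- Here i is `suc n`: the orbit is back at x, which has an image because the loop has positive
    -- length.
    ... | zero  | refl = x , loop , iterate⇒Dom n loop
    ... | suc k | eq with y , before , after ← iterate-split (suc k) eq loop =
      y , before , iterate⇒Dom k after

  Fix⇒Per : Fix p ⊆ Per p
  Fix⇒Per fix = loop⇒Per 0 fix

  -- The orbit has N + 1 terms, so two of them coincide, say at times i < j. Injectivity cancels the
  -- first i steps, and x itself returns after j - i steps.
  long-orbit⇒Per : ∀ {N} → FiniteMetricSpace.size M ℕ.≤ N →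
    ∀ {x y} → iterate p N x ≡ just y → Per p x
  long-orbit⇒Per {N} size≤N {x} {y} defined =
    let i , j , i<j , eq = Fin.pigeonhole (ℕ.s≤s size≤N)
          (Inverse.to (FiniteMetricSpace.finite M) ∘ proj₁ ∘ point)
    in loop (ℕ.m∸n+n≡m i<j) (proj₂ (point i))
        (trans (proj₂ (point j)) (cong just (sym (Injection.injective (↔⇒↣ (FiniteMetricSpace.finite M)) eq))))
    where
    point : (i : Fin (suc N)) → ∃[ z ] iterate p (toℕ i) x ≡ just z
    point i with z , eq , _ ← iterate-split (N ℕ.∸ toℕ i) (ℕ.m∸n+n≡m (Fin.toℕ≤pred[n] i)) defined = z , eq

    loop : ∀ {i j k z} → k ℕ.+ suc i ≡ j → iterate p i x ≡ just z → iterate p j x ≡ just z → Per p x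
    loop {i} {j} {k} eq at-i at-j
      -- v is reached from x after `suc k` = j - i steps, and i further steps take both v and x to
      -- z; hence v = x.
      with v , before , after ← iterate-split i {suc k} (trans (trans (ℕ.+-comm i (suc k)) (sym (ℕ.+-suc k i))) eq) at-j
      with refl ← iterate-injective i after at-i
      = loop⇒Per k before

-- Minima and uniform bounds over finite sets

argmin-Fin : ExcludedMiddle 0ℓ → ∀ {n} (Q : Fin n → Set) (f : Fin n → ℝ) →
  ∃[ i ] Q i → ∃[ i ] (Q i × (∀ j → Q j → f i ≼ f j))
argmin-Fin em {suc n} Q f satisfiable with em {∃[ i ] Q (suc i)} | em {Q zero}
argmin-Fin em Q f (zero  , q₀) | no none | _ =
  zero , q₀ , λ where zero _ → ≼-refl ; (suc j) qⱼ → contradiction (j , qⱼ) none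
argmin-Fin em Q f (suc i , qᵢ) | no none | _ = contradiction (i , qᵢ) none
argmin-Fin em Q f _ | yes some | q₀?
  with i , qᵢ , least ← argmin-Fin em (Q ∘ suc) (f ∘ suc) some
  with q₀? | ≼-total em (f zero) (f (suc i))
... | no ¬q₀ | _         = suc i , qᵢ , λ where
  zero    q₀ → contradiction q₀ ¬q₀
  (suc j) qⱼ → least j qⱼ
... | yes q₀ | inj₁ f₀≼  = zero , q₀ , λ where
  zero    _  → ≼-refl
  (suc j) qⱼ → ≼-trans f₀≼ (least j qⱼ)
... | yes q₀ | inj₂ ≼f₀  = suc i , qᵢ , λ where
  zero    _  → ≼f₀
  (suc j) qⱼ → least j qⱼ

argmin : ExcludedMiddle 0ℓ → ∀ {X : Set} {n} → X ↔ Fin n → (Q : X → Set) (f : X → ℝ) →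
  ∃[ x ] Q x → ∃[ x ] (Q x × (∀ y → Q y → f x ≼ f y))
argmin em X↔Fin Q f (x , qₓ) =
  let i , qᵢ , least = argmin-Fin em (Q ∘ from) (f ∘ from)
                         (index x , subst Q (sym (from-index x)) qₓ)
  in from i , qᵢ , λ y q → subst (λ z → f (from i) ≼ f z) (from-index y)
                             (least (index y) (subst Q (sym (from-index y)) q))
  where open Inverse X↔Fin using (from) renaming (to to index; strictlyInverseʳ to from-index)

uniform-bound-Fin : ∀ {n} (P : Fin n → ℕ → Set) →
  (∀ i {j k} → j ℕ.≤ k → P i j → P i k) → (∀ i → ∃[ k ] P i k) → ∃[ k ] (∀ i → P i k)
uniform-bound-Fin {zero}  P mono bound = 0 , λ ()
uniform-bound-Fin {suc n} P mono bound
  with j , P₀ⱼ ← bound zero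
     | k , Pₖ ← uniform-bound-Fin (P ∘ suc) (mono ∘ suc) (bound ∘ suc)
  = j ⊔ k , λ where
    zero    → mono zero (ℕ.m≤m⊔n j k) P₀ⱼ
    (suc i) → mono (suc i) (ℕ.m≤n⊔m j k) (Pₖ i)

uniform-bound : ∀ {X : Set} {n} → X ↔ Fin n → (P : X → ℕ → Set) →
  (∀ x {j k} → j ℕ.≤ k → P x j → P x k) → (∀ x → ∃[ k ] P x k) → ∃[ k ] (∀ x → P x k)
uniform-bound X↔Fin P mono bound =
  let k , Pₖ = uniform-bound-Fin (P ∘ from) (mono ∘ from) (bound ∘ from)
  in k , λ x → subst (λ z → P z k) (from-index x) (Pₖ (index x))
  where open Inverse X↔Fin using (from) renaming (to to index; strictlyInverseʳ to from-index)

-- Pairs of partial isometries and their extensions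

record System : Set₁ where
  constructor system
  field
    space : FiniteMetricSpace
    act   : Generator → PartialIsometry space

  Point : Set
  Point = Carrier space

  dist : Point → Point → ℝ
  dist = d space

open System

infix 4 _⟨_⟩_↦_
_⟨_⟩_↦_ : (S : System) → Generator → Point S → Point S → Set
S ⟨ g ⟩ x ↦ y = fun (act S g) x ≡ just y

-- Such a point keeps every domain nonempty, so that the minimum in a one-point extension exists,
-- and later provides the path with which the Archimedean bound is compared.
CommonFixedPoint : System → Set
CommonFixedPoint S = ∃[ z ] (∀ g → S ⟨ g ⟩ z ↦ z)

-- T enlarges S by moving points along generators satisfying G.  By `free`, a
-- distance from a point of S to the image of x under g is attained by a path
-- through the graph of g inside S, however many further points T has.
record Extension (G : Generator → Set) (S T : System) : Set where
  field
    embedding : space S ↪ space T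
    extends   : ∀ g → Extends embedding (act T g) (act S g)
    periodic  : ∀ g → Per (act T g) ⊆ image (to embedding) (Per (act S g))
    semigroup : ∀ x y → AdditiveSemigroup (Distances (space S)) (dist T x y)
    free      : ∀ {g x x′} → T ⟨ g ⟩ x ↦ x′ → ∀ y → ∃[ u ] ∃[ u′ ]
                (S ⟨ g ⟩ u ↦ u′ × dist T x (to embedding u) ⊕ dist S u′ y ≼ dist T x′ (to embedding y))
    inactive  : ∀ g → ¬ G g → Dom (act T g) ⊆ image (to embedding) (Dom (act S g))

  ι : Point S → Point T
  ι = to embedding

≈-refl : ∀ x → x ≈ x
≈-refl x = ≼-antisym {x} {x} ≼-refl ≼-refl

≈-trans : ∀ {x y z} → x ≈ y → y ≈ z → x ≈ z
≈-trans {x} {y} {z} x≈y y≈z = ≼-antisym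
  (≼-trans (≈⇒≼ {x} {y} x≈y) (≈⇒≼ {y} {z} y≈z))
  (≼-trans (≈⇒≽ {y} {z} y≈z) (≈⇒≽ {x} {y} x≈y))

semigroup-resp-≈ : ∀ {S x y} → x ≈ y → AdditiveSemigroup S y → AdditiveSemigroup S x
semigroup-resp-≈ {x = x} {y} x≈y (generator {s = z} Sz y≈z) =
  generator Sz (≈-trans {x} {y} {z} x≈y y≈z)
semigroup-resp-≈ {x = x} {y} x≈y (sum {s = u} {v} ⟨S⟩u ⟨S⟩v y≈u+v) =
  sum ⟨S⟩u ⟨S⟩v (≈-trans {x} {y} {u + v} x≈y y≈u+v)

semigroup-join : ∀ {S T} → T ⊆ AdditiveSemigroup S → AdditiveSemigroup T ⊆ AdditiveSemigroup S
semigroup-join T⊆ (generator Ts r≈s)  = semigroup-resp-≈ r≈s (T⊆ Ts)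
semigroup-join T⊆ (sum ⟨T⟩r ⟨T⟩s eq) = sum (semigroup-join T⊆ ⟨T⟩r) (semigroup-join T⊆ ⟨T⟩s) eq

refl-extension : ∀ {G} S → Extension G S S
refl-extension S = record
  { embedding = record { to = λ x → x ; isometric = λ x y → ≈-refl (dist S x y) }
  ; extends   = λ g x y eq → eq
  ; periodic  = λ g {x} per → x , per , refl
  ; semigroup = λ x y → generator (x , y , refl) (≈-refl (dist S x y))
  ; free      = λ {g} {x} {x′} x↦x′ y → x , x′ , x↦x′ , (begin
      dist S x x ⊕ dist S x′ y  ∼⟨ ⊕-monoˡ-≼ _ (d-refl-≼ (space S) x) ⟩
      0ℝ ⊕ dist S x′ y          ∼⟨ ⊕-comm-≼ _ _ ⟩
      dist S x′ y ⊕ 0ℝ          ∼⟨ ⊕-identityʳ-≼ _ ⟩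
      dist S x′ y               ∎)
  ; inactive  = λ g _ {x} dom → x , dom , refl
  }
  where open ≼-Reasoning

module _ {G : Generator → Set} {S T V : System} where
  trans-extension : Extension G S T → Extension G T V → Extension G S V
  trans-extension E F = record
    { embedding = record
      { to = F.ι ∘ E.ι
      ; isometric = λ x y → ≼-antisym
          (≼-trans (embed-≼ F.embedding (E.ι x) (E.ι y)) (embed-≼ E.embedding x y))
          (≼-trans (embed-≽ E.embedding x y) (embed-≽ F.embedding (E.ι x) (E.ι y)))
      }
    ; extends   = λ g x y eq → F.extends g _ _ (E.extends g x y eq)
    ; periodic  = λ g per → image-trans (F.periodic g per) (E.periodic g)
    ; semigroup = λ x y → semigroup-join (λ { {r} (u , v , refl) → E.semigroup u v }) (F.semigroup x y)
    ; free      = free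
    ; inactive  = λ g ¬Gg dom → image-trans (F.inactive g ¬Gg dom) (E.inactive g ¬Gg)
    }
    where
    module E = Extension E
    module F = Extension F

    image-trans : {P : Pred (Point S) 0ℓ} {Q : Pred (Point T) 0ℓ} →
      ∀ {x} → image F.ι Q x → Q ⊆ image E.ι P → image (F.ι ∘ E.ι) P x
    image-trans (y , Qy , refl) Q⊆ with z , Pz , refl ← Q⊆ Qy = z , Pz , refl

    free : ∀ {g x x′} → V ⟨ g ⟩ x ↦ x′ → ∀ y → ∃[ u ] ∃[ u′ ]
      (S ⟨ g ⟩ u ↦ u′ × dist V x (F.ι (E.ι u)) ⊕ dist S u′ y ≼ dist V x′ (F.ι (E.ι y)))
    free {x = x} {x′} x↦x′ y
      -- The path in V passes through an edge v ↦ v′ of T; its remaining part, from v′ to y, is in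
      -- turn rerouted through an edge of S. The triangle inequality merges the two pieces before
      -- the edges.
      with v , v′ , v↦v′ , v-path ← F.free x↦x′ (E.ι y)
      with u , u′ , u↦u′ , u-path ← E.free v↦v′ y
      = u , u′ , u↦u′ , (begin
        dist V x (F.ι (E.ι u)) ⊕ dist S u′ y
          ∼⟨ ⊕-monoˡ-≼ _ (d-triangle-≼ (space V) x (F.ι v) (F.ι (E.ι u))) ⟩
        dist V x (F.ι v) ⊕ dist V (F.ι v) (F.ι (E.ι u)) ⊕ dist S u′ y
          ∼⟨ ⊕-assoc-≼ _ _ _ ⟩
        dist V x (F.ι v) ⊕ (dist V (F.ι v) (F.ι (E.ι u)) ⊕ dist S u′ y)
          ∼⟨ ⊕-monoʳ-≼ _ (⊕-monoˡ-≼ _ (embed-≼ F.embedding v (E.ι u))) ⟩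
        dist V x (F.ι v) ⊕ (dist T v (E.ι u) ⊕ dist S u′ y)
          ∼⟨ ⊕-monoʳ-≼ _ u-path ⟩
        dist V x (F.ι v) ⊕ dist T v′ (E.ι y)
          ∼⟨ v-path ⟩
        dist V x′ (F.ι (E.ι y)) ∎)
      where open ≼-Reasoning

open ≼-Reasoning hiding (start)

-- The one-point extension

module OnePoint (em : ExcludedMiddle 0ℓ) (S : System) (g : Generator) (a : Point S)
  (a∉dom : ¬ Dom (act S g) a) (dom-nonempty : ∃[ u ] Dom (act S g) u) where

  X : Set
  X = Point S

  through : X → X → ℝ
  -- The default 0 is never compared: `argmin` ranges over the domain only.
  through y u = maybe (λ u′ → dist S a u ⊕ dist S u′ y) 0ℝ (fun (act S g) u)

  nearest : ∀ y → ∃[ u ] (Dom (act S g) u × (∀ v → Dom (act S g) v → through y u ≼ through y v))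
  nearest y = argmin em (FiniteMetricSpace.finite (space S)) (Dom (act S g)) (through y) dom-nonempty

  via via′ : X → X
  via y  = proj₁ (nearest y)
  via′ y = proj₁ (proj₁ (proj₂ (nearest y)))

  via↦via′ : ∀ y → S ⟨ g ⟩ via y ↦ via′ y
  via↦via′ y = proj₂ (proj₁ (proj₂ (nearest y)))

  δ : X → ℝ
  δ y = dist S a (via y) ⊕ dist S (via′ y) y

  through-just : ∀ y {u u′} → S ⟨ g ⟩ u ↦ u′ → through y u ≡ dist S a u ⊕ dist S u′ y
  through-just y {u} u↦u′ = cong (maybe (λ u′ → dist S a u ⊕ dist S u′ y) 0ℝ) u↦u′

  δ-least : ∀ y {u u′} → S ⟨ g ⟩ u ↦ u′ → δ y ≼ dist S a u ⊕ dist S u′ y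
  δ-least y {u} {u′} u↦u′ = begin
    δ y                        ≡⟨ through-just y (via↦via′ y) ⟨
    through y (via y)          ∼⟨ proj₂ (proj₂ (nearest y)) u (u′ , u↦u′) ⟩
    through y u                ≡⟨ through-just y u↦u′ ⟩
    dist S a u ⊕ dist S u′ y   ∎

  dist⁺ : Maybe X → Maybe X → ℝ
  dist⁺ (just x) (just y) = dist S x y
  dist⁺ (just x) nothing  = δ x
  dist⁺ nothing  (just y) = δ y
  dist⁺ nothing  nothing  = 0ℝ

  opaque
    0≼δ : ∀ y → 0ℝ ≼ δ y
    0≼δ y = ≼-trans (0≼d (space S) a (via y)) (x≼x⊕y _ (0≼d (space S) (via′ y) y))

    -- Distance zero would make `a` coincide with `via y`, a point of the domain.
    δ-separate : ∀ y → ¬ δ y ≼ 0ℝ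
    δ-separate y δ≼0 = a∉dom (subst (Dom (act S g)) (sym a≡via) (via′ y , via↦via′ y))
      where
      a≡via : a ≡ via y
      a≡via = d≼0⇒≡ (space S) (≼-trans (x≼x⊕y _ (0≼d (space S) (via′ y) y)) δ≼0)

    δ-triangle : ∀ y z → δ z ≼ δ y ⊕ dist S y z
    δ-triangle y z = begin
      δ z                                                    ∼⟨ δ-least z (via↦via′ y) ⟩
      dist S a (via y) ⊕ dist S (via′ y) z                   ∼⟨ ⊕-monoʳ-≼ _ (d-triangle-≼ (space S) (via′ y) y z) ⟩
      dist S a (via y) ⊕ (dist S (via′ y) y ⊕ dist S y z)    ∼⟨ ⊕-assoc-≽ _ _ _ ⟩
      δ y ⊕ dist S y z                                       ∎

    -- This is where the map being an isometry matters: the distance between `via′ y` and `via′ z`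
    -- is pulled back to that between `via y` and `via z`, which can be travelled through `a`.
    δ-triangle′ : ∀ y z → dist S y z ≼ δ y ⊕ δ z
    δ-triangle′ y z = begin
      dist S y z
        ∼⟨ d-triangle-≼ (space S) y (via′ y) z ⟩
      dist S y (via′ y) ⊕ dist S (via′ y) z
        ∼⟨ ⊕-mono-≼ (d-sym-≼ (space S) y (via′ y)) (d-triangle-≼ (space S) (via′ y) (via′ z) z) ⟩
      dist S (via′ y) y ⊕ (dist S (via′ y) (via′ z) ⊕ dist S (via′ z) z)
        ∼⟨ ⊕-monoʳ-≼ _ (⊕-monoˡ-≼ _ (isometric-≼ (act S g) (via↦via′ y) (via↦via′ z))) ⟩
      dist S (via′ y) y ⊕ (dist S (via y) (via z) ⊕ dist S (via′ z) z)
        ∼⟨ ⊕-monoʳ-≼ _ (⊕-monoˡ-≼ _ (d-triangle-≼ (space S) (via y) a (via z))) ⟩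
      dist S (via′ y) y ⊕ (dist S (via y) a ⊕ dist S a (via z) ⊕ dist S (via′ z) z)
        ∼⟨ ⊕-monoʳ-≼ _ (⊕-monoˡ-≼ _ (⊕-monoˡ-≼ _ (d-sym-≼ (space S) (via y) a))) ⟩
      dist S (via′ y) y ⊕ (dist S a (via y) ⊕ dist S a (via z) ⊕ dist S (via′ z) z)
        ∼⟨ ⊕-regroup _ _ _ _ ⟩
      δ y ⊕ δ z ∎

    dist⁺-nonNeg : ∀ x y → 0ℝ ≼ dist⁺ x y
    dist⁺-nonNeg (just x) (just y) = 0≼d (space S) x y
    dist⁺-nonNeg (just x) nothing  = 0≼δ x
    dist⁺-nonNeg nothing  (just y) = 0≼δ y
    dist⁺-nonNeg nothing  nothing  = ≼-refl

    dist⁺-refl : ∀ x → dist⁺ x x ≈ 0ℝ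
    dist⁺-refl (just x) = FiniteMetricSpace.d-refl (space S) x
    dist⁺-refl nothing  = ≈-refl 0ℝ

    dist⁺-separate : ∀ x y → dist⁺ x y ≼ 0ℝ → x ≡ y
    dist⁺-separate (just x) (just y) d≼0 = cong just (d≼0⇒≡ (space S) d≼0)
    dist⁺-separate (just x) nothing  δ≼0 = contradiction δ≼0 (δ-separate x)
    dist⁺-separate nothing  (just y) δ≼0 = contradiction δ≼0 (δ-separate y)
    dist⁺-separate nothing  nothing  _   = refl

    dist⁺-sym : ∀ x y → dist⁺ x y ≈ dist⁺ y x
    dist⁺-sym (just x) (just y) = FiniteMetricSpace.d-sym (space S) x y
    dist⁺-sym (just x) nothing  = ≈-refl (δ x)
    dist⁺-sym nothing  (just y) = ≈-refl (δ y)
    dist⁺-sym nothing  nothing  = ≈-refl 0ℝ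

    dist⁺-triangle : ∀ x y z → dist⁺ x z ≼ dist⁺ x y ⊕ dist⁺ y z
    dist⁺-triangle (just x) (just y) (just z) = d-triangle-≼ (space S) x y z
    dist⁺-triangle (just x) (just y) nothing  = begin
      δ x               ∼⟨ δ-triangle y x ⟩
      δ y ⊕ dist S y x  ∼⟨ ⊕-monoʳ-≼ _ (d-sym-≼ (space S) y x) ⟩
      δ y ⊕ dist S x y  ∼⟨ ⊕-comm-≼ _ _ ⟩
      dist S x y ⊕ δ y  ∎
    dist⁺-triangle (just x) nothing  (just z) = δ-triangle′ x z
    dist⁺-triangle (just x) nothing  nothing  = ⊕-identityʳ-≽ _
    dist⁺-triangle nothing  (just y) (just z) = δ-triangle y z
    dist⁺-triangle nothing  (just y) nothing  = ≼-trans (0≼δ y) (x≼x⊕y _ (0≼δ y))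
    dist⁺-triangle nothing  nothing  (just z) = x≼y⊕x _ ≼-refl
    dist⁺-triangle nothing  nothing  nothing  = ⊕-identityʳ-≽ _

  Maybe↔Fin : ∀ {n} → X ↔ Fin n → Maybe X ↔ Fin (suc n)
  Maybe↔Fin X↔Fin = mk↔ₛ′ (maybe (suc ∘ index) zero)
    (λ { zero → nothing ; (suc i) → just (from i) })
    (λ { zero → refl ; (suc i) → cong suc (strictlyInverseˡ i) })
    (λ { nothing → refl ; (just x) → cong just (strictlyInverseʳ x) })
    where open Inverse X↔Fin using (from; strictlyInverseˡ; strictlyInverseʳ) renaming (to to index)

  space⁺ : FiniteMetricSpace
  space⁺ = record
    { Carrier    = Maybe X
    ; size       = suc (FiniteMetricSpace.size (space S))
    ; finite     = Maybe↔Fin (FiniteMetricSpace.finite (space S))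
    ; d          = dist⁺
    ; d-nonNeg   = λ x y → _≼_.unwrap (dist⁺-nonNeg x y)
    ; d-refl     = dist⁺-refl
    ; d-separate = λ {x} {y} eq → dist⁺-separate x y (≈⇒≼ {dist⁺ x y} {0ℝ} eq)
    ; d-sym      = dist⁺-sym
    ; d-triangle = λ x y z → ≼-⊕⇒≤-+ (dist⁺-triangle x y z)
    }

  -- The decision is an argument, so that `extend-yes` can analyse it without reference to the
  -- outcome of `em`. Values that exist already take precedence.
  extend : ∀ {P : Set} → Dec P → Maybe X → Maybe (Maybe X)
  extend _       (just x) = just (just x)
  extend (yes _) nothing  = just nothing
  extend (no _)  nothing  = nothing

  fun⁺ : Generator → Maybe X → Maybe (Maybe X)
  fun⁺ h nothing  = nothing
  fun⁺ h (just x) = extend (em {h ≡ g × x ≡ a}) (fun (act S h) x)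

  data Step : Generator → Maybe X → Maybe X → Set where
    old : ∀ {h x x′} → S ⟨ h ⟩ x ↦ x′ → Step h (just x) (just x′)
    new : Step g (just a) nothing

  fun⁺⇒Step : ∀ {h} x {y} → fun⁺ h x ≡ just y → Step h x y
  fun⁺⇒Step {h} (just x) eq with fun (act S h) x in x↦ | em {h ≡ g × x ≡ a}
  fun⁺⇒Step (just x) refl | just x′ | _                 = old x↦
  fun⁺⇒Step (just x) refl | nothing | yes (refl , refl) = new

  old⇒fun⁺ : ∀ h {x x′} → S ⟨ h ⟩ x ↦ x′ → fun⁺ h (just x) ≡ just (just x′)
  old⇒fun⁺ h x↦x′ rewrite x↦x′ = refl

  extend-yes : ∀ {P : Set} (P? : Dec P) {m} → P → ¬ (∃[ y ] m ≡ just y) → extend P? m ≡ just nothing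
  extend-yes _       {just y}  _  undefined = contradiction (y , refl) undefined
  extend-yes (yes _) {nothing} _  _         = refl
  extend-yes (no ¬p) {nothing} p  _         = contradiction p ¬p

  new⇒fun⁺ : fun⁺ g (just a) ≡ just nothing
  new⇒fun⁺ = extend-yes em (refl , refl) a∉dom

  opaque
    -- One bound takes v itself as the intermediate point. For the other, the leg from `via′ v′` to
    -- v′ is pulled back to one from `via v′` to v, after which the triangle inequality applies.
    δ-isometric : ∀ {v v′} → S ⟨ g ⟩ v ↦ v′ → δ v′ ≈ dist S a v
    δ-isometric {v} {v′} v↦v′ = ≼-antisym
      (begin
        δ v′                        ∼⟨ δ-least v′ v↦v′ ⟩
        dist S a v ⊕ dist S v′ v′   ∼⟨ ⊕-monoʳ-≼ _ (d-refl-≼ (space S) v′) ⟩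
        dist S a v ⊕ 0ℝ             ∼⟨ ⊕-identityʳ-≼ _ ⟩
        dist S a v                  ∎)
      (begin
        dist S a v                                    ∼⟨ d-triangle-≼ (space S) a (via v′) v ⟩
        dist S a (via v′) ⊕ dist S (via v′) v         ∼⟨ ⊕-monoʳ-≼ _ (isometric-≽ (act S g) (via↦via′ v′) v↦v′) ⟩
        δ v′                                          ∎)

    Step-isometric : ∀ {h x y x′ y′} → Step h x x′ → Step h y y′ → dist⁺ x′ y′ ≈ dist⁺ x y
    Step-isometric {h} (old x↦x′) (old y↦y′) = PartialIsometry.isometric (act S h) x↦x′ y↦y′
    Step-isometric {x = just x} {x′ = just x′} (old x↦x′) new =
      ≈-trans {δ x′} {dist S a x} {dist S x a} (δ-isometric x↦x′) (FiniteMetricSpace.d-sym (space S) a x)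
    Step-isometric new (old y↦y′) = δ-isometric y↦y′
    Step-isometric new new = ≈-sym {dist S a a} {0ℝ} (FiniteMetricSpace.d-refl (space S) a)

  system⁺ : System
  system⁺ = system space⁺ λ h → record
    { fun = fun⁺ h
    ; isometric = λ {x} {y} x↦ y↦ → Step-isometric (fun⁺⇒Step x x↦) (fun⁺⇒Step y y↦)
    }

  Dom⁺⇒just : ∀ {h} x → Dom (act system⁺ h) x → ∃[ y ] x ≡ just y
  Dom⁺⇒just (just x) _ = x , refl

  -- The new point has no image, so an orbit all of whose points have images never visits it and
  -- already runs in S.
  old-orbit : ∀ {h n y} →
    (∀ i → i ℕ.≤ n → ∃[ v ] (iterate (act system⁺ h) i (just y) ≡ just v × Dom (act system⁺ h) v)) →
    ∀ i → i ℕ.≤ n →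
    ∃[ z ] (iterate (act S h) i y ≡ just z × iterate (act system⁺ h) i (just y) ≡ just (just z))
  old-orbit {y = y} orbit zero    _   = y , refl , refl
  old-orbit {h}     orbit (suc i) i<n
    with z , at-i , at-i⁺ ← old-orbit orbit i (ℕ.<⇒≤ i<n)
       | v , at-v⁺ , v-dom ← orbit (suc i) i<n
    with v′ , refl ← Dom⁺⇒just v v-dom
    with old z↦v′ ← fun⁺⇒Step (just z) (trans (sym (cong (_>>= fun⁺ h) at-i⁺)) at-v⁺)
    = v′ , trans (cong (_>>= fun (act S h)) at-i) z↦v′ , at-v⁺

  Per⁺ : ∀ h → Per (act system⁺ h) ⊆ image just (Per (act S h))
  Per⁺ h {x} (suc n , _ , orbit , loop)
    with _ , refl , x-dom ← orbit 0 ℕ.z≤n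
    with y , refl ← Dom⁺⇒just x x-dom
    with z , at-n , at-n⁺ ← old-orbit orbit (suc n) ℕ.≤-refl
    with refl ← trans (sym at-n⁺) loop
    = y , loop⇒Per (act S h) n at-n , refl

  extension⁺ : ∀ {G : Generator → Set} → G g → Extension G S system⁺
  extension⁺ Gg = record
    { embedding = record { to = just ; isometric = λ x y → ≈-refl (dist S x y) }
    ; extends   = λ h x y → old⇒fun⁺ h
    ; periodic  = Per⁺
    ; semigroup = semigroup⁺
    ; free      = λ {h} {x} x↦x′ y → free⁺ (fun⁺⇒Step x x↦x′) y
    ; inactive  = λ h ¬Gh {x} (x′ , x↦x′) → inactive⁺ Gg ¬Gh (fun⁺⇒Step x x↦x′)
    }
    where
    ⟨S⟩ : ℝ → Set
    ⟨S⟩ = AdditiveSemigroup (Distances (space S))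

    δ-semigroup : ∀ y → ⟨S⟩ (δ y)
    δ-semigroup y = sum {s = dist S a (via y)} {t = dist S (via′ y) y}
      (generator (a , via y , refl) (≈-refl (dist S a (via y))))
      (generator (via′ y , y , refl) (≈-refl (dist S (via′ y) y)))
      (≼-⊕⇒≈-+ ≼-refl ≼-refl)

    semigroup⁺ : ∀ x y → ⟨S⟩ (dist⁺ x y)
    semigroup⁺ (just x) (just y) = generator (x , y , refl) (≈-refl (dist S x y))
    semigroup⁺ (just x) nothing  = δ-semigroup x
    semigroup⁺ nothing  (just y) = δ-semigroup y
    -- The semigroup has no built-in zero; zero enters as the distance from `a` to itself.
    semigroup⁺ nothing  nothing  =
      generator (a , a , refl) (≈-sym {dist S a a} {0ℝ} (FiniteMetricSpace.d-refl (space S) a))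

    free⁺ : ∀ {h x x′} → Step h x x′ → ∀ y → ∃[ u ] ∃[ u′ ]
      (S ⟨ h ⟩ u ↦ u′ × dist⁺ x (just u) ⊕ dist S u′ y ≼ dist⁺ x′ (just y))
    free⁺ (old {x = u} {u′} u↦u′) y = Extension.free (refl-extension {λ _ → X} S) u↦u′ y
    free⁺ new y = via y , via′ y , via↦via′ y , ≼-refl

    inactive⁺ : ∀ {G : Generator → Set} {h x x′} → G g → ¬ G h → Step h x x′ → image just (Dom (act S h)) x
    inactive⁺ _  _   (old {x = u} {u′} u↦u′) = u , (u′ , u↦u′) , refl
    inactive⁺ Gg ¬Gh new = contradiction Gg ¬Gh

-- Positive words

defined-at : ExcludedMiddle 0ℓ → ∀ {G : Generator → Set} S → CommonFixedPoint S →
  ∀ {g} → G g → ∀ x → Σ[ T ∈ System ] Σ[ E ∈ Extension G S T ] Dom (act T g) (Extension.ι E x)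
defined-at em S (z , z-fixed) {g} Gg x with em {Dom (act S g) x}
... | yes x∈dom = S , refl-extension S , x∈dom
... | no  x∉dom = system⁺ , extension⁺ Gg , nothing , new⇒fun⁺
  where open OnePoint em S g x x∉dom (z , z , z-fixed g)

fixed⁺ : ∀ {G S T} → Extension G S T → CommonFixedPoint S → CommonFixedPoint T
fixed⁺ E (z , z-fixed) = Extension.ι E z , λ g → Extension.extends E g z z (z-fixed g)

defined-on : ExcludedMiddle 0ℓ → ∀ {G : Generator → Set} S → CommonFixedPoint S →
  ∀ {g} → G g → ∀ {n} (x : Fin n → Point S) →
  Σ[ T ∈ System ] Σ[ E ∈ Extension G S T ] (∀ i → Dom (act T g) (Extension.ι E (x i)))
defined-on em S fixed Gg {zero}  x = S , refl-extension S , λ ()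
defined-on em S fixed {g} Gg {suc n} x
  with T , E , dom ← defined-on em S fixed Gg (x ∘ suc)
  with V , F , dom₀ ← defined-at em T (fixed⁺ E fixed) Gg (Extension.ι E (x zero))
  = V , trans-extension E F , λ where
    zero    → dom₀
    (suc i) → let y , x↦y = dom i in Extension.ι F y , Extension.extends F g _ _ x↦y

-- As in Defs, the head of the list acts last.
data Run (S : System) : List Generator → Point S → Point S → Set where
  []  : ∀ {x} → Run S [] x x
  _∷_ : ∀ {g w x y z} → S ⟨ g ⟩ y ↦ z → Run S w x y → Run S (g ∷ w) x z

module _ {S : System} where

  run-join : ∀ {u v x y z} → Run S u y z → Run S v x y → Run S (u ++ v) x z
  run-join []         run = run
  run-join (st ∷ run) run′ = st ∷ run-join run run′

  run-split : ∀ u {v x z} → Run S (u ++ v) x z → ∃[ y ] (Run S v x y × Run S u y z)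
  run-split []      run = _ , run , []
  run-split (g ∷ u) (st ∷ run) with y , run₁ , run₂ ← run-split u run = y , run₁ , st ∷ run₂

  run-deterministic : ∀ {w x y z} → Run S w x y → Run S w x z → y ≡ z
  run-deterministic []         []           = refl
  run-deterministic (st ∷ run) (st′ ∷ run′)
    with refl ← run-deterministic run run′ = just-injective (trans (sym st) st′)

  run-fixed : ∀ {x} w → (∀ g → S ⟨ g ⟩ x ↦ x) → Run S w x x
  run-fixed []      fix = []
  run-fixed (g ∷ w) fix = fix g ∷ run-fixed w fix

  run-power : ∀ {w x} n → Run S w x x → Run S (concat (replicate n w)) x x
  run-power zero    run = []
  run-power (suc n) run = run-join run (run-power n run)

  run-isometric : ∀ {w x x′ y y′} → Run S w x x′ → Run S w y y′ → dist S x y ≼ dist S x′ y′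
  run-isometric []         []           = ≼-refl
  run-isometric (_∷_ {g = g} st run) (st′ ∷ run′) =
    ≼-trans (run-isometric run run′) (isometric-≽ (act S g) st st′)

  run-isometric′ : ∀ {w x x′ y y′} → Run S w x x′ → Run S w y y′ → dist S x′ y′ ≼ dist S x y
  run-isometric′ []         []           = ≼-refl
  run-isometric′ (_∷_ {g = g} st run) (st′ ∷ run′) =
    ≼-trans (isometric-≼ (act S g) st st′) (run-isometric′ run run′)

  run-replicate : ∀ n {g x y} → Run S (replicate n g) x y → iterate (act S g) n x ≡ just y
  run-replicate zero    []         = refl
  run-replicate (suc n) {g} (st ∷ run) = trans (cong (_>>= fun (act S g)) (run-replicate n run)) st

run-extend : ∀ {G S T} (E : Extension G S T) {w x y} →
  Run S w x y → Run T w (Extension.ι E x) (Extension.ι E y)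
run-extend E []         = []
run-extend E (_∷_ {g = g} st run) = Extension.extends E g _ _ st ∷ run-extend E run

-- The tail acts first and is treated first; the head is then made defined at all the endpoints
-- reached, while the earlier runs persist in the larger system.
word-defined-on : ExcludedMiddle 0ℓ → ∀ {G : Generator → Set} S → CommonFixedPoint S →
  ∀ {w} → All G w → ∀ {n} (x : Fin n → Point S) →
  Σ[ T ∈ System ] Σ[ E ∈ Extension G S T ] (∀ i → ∃[ y ] Run T w (Extension.ι E (x i)) y)
word-defined-on em S fixed []         x = S , refl-extension S , λ i → x i , []
word-defined-on em S fixed (Gg ∷ Gw) x
  with T , E , runs ← word-defined-on em S fixed Gw x
  with V , F , dom ← defined-on em T (fixed⁺ E fixed) Gg (λ i → proj₁ (runs i))
  = V , trans-extension E F , λ i →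
    let y , x↦y = dom i in y , x↦y ∷ run-extend F (proj₂ (runs i))

-- Free position along powers of a word

-- When a power of `w` leads from x to x′, it also fixes z, so d(x, z) = d(x′, z). The inequality
-- then says that a shortest path from x′ to y passes through z.
FreeOver : ∀ {G S T} → Extension G S T → List Generator → Point T → Point T → Point S → Set
FreeOver {S = S} {T} E w x x′ y =
  ∃[ z ] (Run S w z z × dist T x (ι z) ⊕ dist S z y ≼ dist T x′ (ι y))
  where open Extension E

module _ (em : ExcludedMiddle 0ℓ) (S : System)
  (r : ℝ) (r-gap : ∀ x y → x ≢ y → r ≼ dist S x y)
  {G : Generator → Set} {T : System} (E : Extension G S T) where
  open Extension E

  -- A run to x′ in T is matched, step by step from its end, by a path in S that ends at y:
  -- `cost` is the total length of its jumps.
  record Backtrack (w : List Generator) (x x′ : Point T) (y : Point S) : Set where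
    field
      start   : Point S
      cost    : ℝ
      0≼cost  : 0ℝ ≼ cost
      bound   : dist T x (ι start) ⊕ cost ≼ dist T x′ (ι y)
      follows : ∀ {z z′} → Run S w z z′ → dist S z′ y ≼ dist S z start ⊕ cost
      costly  : r ≼ cost ⊎ Run S w start y

  -- By `free`, the letter acting last can be replaced by an edge u ↦ u′ of S followed by a jump e
  -- from u′ to y; the rest of the run is backtracked from u. A nontrivial jump costs at least r,
  -- and when every jump is trivial the edges form a run in S.
  backtrack : ∀ {w x x′} → Run T w x x′ → ∀ y → Backtrack w x x′ y
  backtrack [] y = record
    { start   = y
    ; cost    = 0ℝ
    ; 0≼cost  = ≼-refl
    ; bound   = ⊕-identityʳ-≼ _
    ; follows = λ { [] → ⊕-identityʳ-≽ _ }
    ; costly  = inj₂ []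
    }
  backtrack {g ∷ w} {x} {x″} (_∷_ {y = x′} x′↦x″ run) y
    with u , u′ , u↦u′ , path ← free x′↦x″ y = record
    { start   = start
    ; cost    = cost ⊕ e
    ; 0≼cost  = ≼-trans 0≼cost (x≼x⊕y _ 0≼e)
    ; bound   = begin
        dist T x (ι start) ⊕ (cost ⊕ e)  ∼⟨ ⊕-assoc-≽ _ _ _ ⟩
        dist T x (ι start) ⊕ cost ⊕ e    ∼⟨ ⊕-monoˡ-≼ _ bound ⟩
        dist T x′ (ι u) ⊕ e              ∼⟨ path ⟩
        dist T x″ (ι y)                  ∎
    ; follows = λ { {z} {z″} (_∷_ {y = z′} z′↦z″ zrun) → begin
        dist S z″ y                   ∼⟨ d-triangle-≼ (space S) z″ u′ y ⟩
        dist S z″ u′ ⊕ e              ∼⟨ ⊕-monoˡ-≼ _ (isometric-≼ (act S g) z′↦z″ u↦u′) ⟩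
        dist S z′ u ⊕ e               ∼⟨ ⊕-monoˡ-≼ _ (follows zrun) ⟩
        dist S z start ⊕ cost ⊕ e     ∼⟨ ⊕-assoc-≼ _ _ _ ⟩
        dist S z start ⊕ (cost ⊕ e)   ∎ }
    ; costly  = costly⁺ costly (em {u′ ≡ y})
    }
    where
    open Backtrack (backtrack run u)
    e : ℝ
    e = dist S u′ y
    0≼e : 0ℝ ≼ e
    0≼e = 0≼d (space S) u′ y
    costly⁺ : r ≼ cost ⊎ Run S w start u → Dec (u′ ≡ y) → r ≼ cost ⊕ e ⊎ Run S (g ∷ w) start y
    costly⁺ (inj₁ r≼cost) _          = inj₁ (≼-trans r≼cost (x≼x⊕y _ 0≼e))
    costly⁺ (inj₂ _)      (no u′≢y)  = inj₁ (≼-trans (r-gap u′ y u′≢y) (x≼y⊕x _ 0≼cost))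
    costly⁺ (inj₂ run′)   (yes refl) = inj₂ (u↦u′ ∷ run′)

  -- Backtracking through the copy of `w` that acts last leaves three cases. If the earlier copies
  -- are far from `start` and this copy is costly, another r is gained. If the earlier copies are
  -- already routed through some z, `follows` carries this from `start` to y. If they are far and
  -- this copy made no jump, rigidity makes y fixed by `w`, and y serves as z.
  power-far : ∀ {w} → (∀ {x y} → Run S w x y → x ≡ y) → ∀ n {x x′} →
    Run T (concat (replicate n w)) x x′ → ∀ y → FreeOver E w x x′ y ⊎ n · r ≼ dist T x′ (ι y)
  power-far rigid zero    {x′ = x′} run y = inj₂ (0≼d (space T) x′ (ι y))
  power-far {w} rigid (suc n) {x} {x″} run y
    with x′ , run₁ , run₂ ← run-split w run
    = conclude costly (power-far rigid n run₁ start)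
    where
    open Backtrack (backtrack run₂ y)
    conclude : r ≼ cost ⊎ Run S w start y → FreeOver E w x x′ start ⊎ n · r ≼ dist T x′ (ι start) →
      FreeOver E w x x″ y ⊎ r ⊕ n · r ≼ dist T x″ (ι y)
    conclude (inj₁ r≼cost) (inj₂ far) = inj₂ (begin
      r ⊕ n · r                    ∼⟨ ⊕-mono-≼ r≼cost far ⟩
      cost ⊕ dist T x′ (ι start)   ∼⟨ ⊕-comm-≼ _ _ ⟩
      dist T x′ (ι start) ⊕ cost   ∼⟨ bound ⟩
      dist T x″ (ι y)              ∎)
    conclude _ (inj₁ (z , z-run , z-path)) = inj₁ (z , z-run , (begin
      dist T x (ι z) ⊕ dist S z y                ∼⟨ ⊕-monoʳ-≼ _ (follows z-run) ⟩
      dist T x (ι z) ⊕ (dist S z start ⊕ cost)   ∼⟨ ⊕-assoc-≽ _ _ _ ⟩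
      dist T x (ι z) ⊕ dist S z start ⊕ cost     ∼⟨ ⊕-monoˡ-≼ _ z-path ⟩
      dist T x′ (ι start) ⊕ cost                 ∼⟨ bound ⟩
      dist T x″ (ι y)                            ∎))
    conclude (inj₂ back) (inj₂ _) = inj₁ (y , loop , (begin
      dist T x (ι y) ⊕ dist S y y
        -- As y is fixed by `w`, the first n copies carry x to x′ and keep y in place, so the
        -- distance to y does not change.
        ∼⟨ ⊕-mono-≼ (run-isometric run₁ (run-extend E (run-power n loop)))
                    (≼-trans (d-refl-≼ (space S) y) 0≼cost) ⟩
      dist T x′ (ι y) ⊕ cost      ≡⟨ cong (λ z → dist T x′ (ι z) ⊕ cost) start≡y ⟨
      dist T x′ (ι start) ⊕ cost  ∼⟨ bound ⟩
      dist T x″ (ι y)             ∎))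
      where
      start≡y : start ≡ y
      start≡y = rigid back
      loop : Run S w y y
      loop = subst (λ z → Run S w z y) start≡y back

-- Minimal distances and the choice of the exponent

module _ (em : ExcludedMiddle 0ℓ) (M : FiniteMetricSpace) where

  closest-pair : (∃[ a ] ∃[ b ] a ≢ b) →
    ∃[ a ] ∃[ b ] (a ≢ b × (∀ x y → x ≢ y → d M a b ≼ d M x y))
  closest-pair (a₀ , b₀ , a₀≢b₀)
    with (a , b) , a≢b , least ← argmin em
      (↔-trans (FiniteMetricSpace.finite M ×-↔ FiniteMetricSpace.finite M) (↔-sym Fin.*↔×))
      (uncurry _≢_) (uncurry (d M)) ((a₀ , b₀) , a₀≢b₀)
    = a , b , a≢b , λ x y → least (x , y)

  distances-bounded : ∀ {r} → 0ℝ ≼ r → ¬ r ≼ 0ℝ → ∀ c →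
    ∃[ n ] (∀ x y → d M x c ⊕ d M c y ≼ n · r)
  distances-bounded {r} 0≼r r⋠0 c =
    uniform-bound finite _ (λ x j≤k bound y → ≼-trans (bound y) (·-monoˡ-≼ 0≼r j≤k)) λ x →
    uniform-bound finite _ (λ y j≤k bound → ≼-trans bound (·-monoˡ-≼ 0≼r j≤k)) λ y →
    archimedean em r⋠0 (d M x c ⊕ d M c y)
    where open FiniteMetricSpace M using (finite)

  gap : ∀ c → ∃[ r ] ∃[ n ] ((∀ x y → x ≢ y → r ≼ d M x y) ×
    (∀ x y → d M x c ⊕ d M c y ≼ suc n · r))
  gap c with em {∃[ a ] ∃[ b ] a ≢ b}
  ... | yes distinct =
    let a , b , a≢b , least = closest-pair distinct
        n , bound = distances-bounded (0≼d M a b) (λ d≼0 → a≢b (d≼0⇒≡ M d≼0)) c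
    -- Relaxing the bound from n to `suc n` makes the number of copies of the word positive.
    in d M a b , n , least , λ x y → ≼-trans (bound x y) (x≼y⊕x _ (0≼d M a b))
  -- Without two distinct points there is no minimal distance, but all distances vanish and r = 0
  -- serves.
  ... | no none = 0ℝ , 0 , (λ x y x≢y → contradiction (x , y , x≢y) none) ,
                  λ x y → ⊕-mono-≼ (trivial x c) (trivial c y)
    where
    trivial : ∀ x y → d M x y ≼ 0ℝ
    trivial x y with em {x ≡ y}
    ... | yes refl = d-refl-≼ M x
    ... | no x≢y   = contradiction (x , y , x≢y) none

  -- All elements are nonnegative, so a sum with one summand at least r is itself at least r. Hence
  -- new points cannot create a positive distance below the old minimum.
  semigroup-gap : ∀ {r} → (∀ x y → x ≢ y → r ≼ d M x y) →
    ∀ {x} → AdditiveSemigroup (Distances M) x → 0ℝ ≼ x × (x ≼ 0ℝ ⊎ r ≼ x)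
  semigroup-gap {r} r-gap {x} (generator (a , b , refl) x≈d) =
    ≼-trans (0≼d M a b) (≈⇒≽ {x} {d M a b} x≈d) , zero-or-far (em {a ≡ b})
    where
    zero-or-far : Dec (a ≡ b) → x ≼ 0ℝ ⊎ r ≼ x
    zero-or-far (yes refl) = inj₁ (≼-trans (≈⇒≼ {x} {d M a a} x≈d) (d-refl-≼ M a))
    zero-or-far (no a≢b)   = inj₂ (≼-trans (r-gap a b a≢b) (≈⇒≽ {x} {d M a b} x≈d))
  semigroup-gap {r} r-gap {x} (sum {s = y} {z} ⟨M⟩y ⟨M⟩z x≈y+z)
    with 0≼y , y-cases ← semigroup-gap r-gap ⟨M⟩y | 0≼z , z-cases ← semigroup-gap r-gap ⟨M⟩z
    = ≼-trans 0≼y (≼-trans (x≼x⊕y y 0≼z) y⊕z≼x) , cases y-cases z-cases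
    where
    y⊕z≼x : y ⊕ z ≼ x
    y⊕z≼x = ≈-+⇒≽-⊕ x≈y+z
    cases : y ≼ 0ℝ ⊎ r ≼ y → z ≼ 0ℝ ⊎ r ≼ z → x ≼ 0ℝ ⊎ r ≼ x
    cases (inj₁ y≼0) (inj₁ z≼0) =
      inj₁ (≼-trans (≈-+⇒≼-⊕ x≈y+z) (≼-trans (⊕-mono-≼ y≼0 z≼0) (⊕-identityʳ-≼ 0ℝ)))
    cases (inj₂ r≼y) _          = inj₂ (≼-trans r≼y (≼-trans (x≼x⊕y y 0≼z) y⊕z≼x))
    cases _          (inj₂ r≼z) = inj₂ (≼-trans r≼z (≼-trans (x≼y⊕x z 0≼y) y⊕z≼x))

  -- The closest pair of M survives in P, and `semigroup-gap` excludes anything closer.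
  IsDen-extension : ∀ {B} (ι : M ↪ B) →
    (∀ x y → AdditiveSemigroup (Distances M) (d B x y)) →
    ∀ {a b} → a ≢ b → (∀ x y → x ≢ y → d M a b ≼ d M x y) →
    ∀ {P} → image (to ι) U ⊆ P → IsDen B P (d M a b)
  IsDen-extension {B} ι ⟨M⟩ {a} {b} a≢b least M⊆P =
    ( d B (to ι a) (to ι b)
    , (to ι a , to ι b , M⊆P (a , tt , refl) , M⊆P (b , tt , refl) , a≢b ∘ embed-injective ι , refl)
    , ≈-sym {d B (to ι a) (to ι b)} {d M a b} (_↪_.isometric ι a b)) , below
    where
    below : ∀ e → ∃[ x ] ∃[ y ] (_ × _ × x ≢ y × e ≡ d B x y) → d M a b ≤ e
    below _ (x , y , _ , _ , x≢y , refl) with proj₂ (semigroup-gap least (⟨M⟩ x y))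
    ... | inj₁ d≼0       = contradiction (d≼0⇒≡ B d≼0) x≢y
    ... | inj₂ (wrap d≤) = d≤

opaque
  -- The exponent depends on S alone, so the word can be chosen before the extension in which it
  -- becomes defined. If `power-far` reports a large distance, the path through the fixed point `c`
  -- is no longer than that distance.
  power-free : ExcludedMiddle 0ℓ → ∀ S {w c} → Run S w c c → (∀ {x y} → Run S w x y → x ≡ y) →
    ∃[ n ] (∀ {G T} (E : Extension G S T) a {x} →
      Run T (concat (replicate (suc n) w)) (Extension.ι E a) x → ∀ y → FreeOver E w (Extension.ι E a) x y)
  power-free em S {w} {c} c-run rigid
    with r , n , r-gap , bound ← gap em (space S) c
    = n , λ {G} {T} E a {x} run y → conclude E a y (bound a y) (power-far em S r r-gap E rigid (suc n) run y)
    where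
    conclude : ∀ {G T ρ x} (E : Extension G S T) a y → dist S a c ⊕ dist S c y ≼ ρ →
      FreeOver E w (Extension.ι E a) x y ⊎ ρ ≼ dist T x (Extension.ι E y) →
      FreeOver E w (Extension.ι E a) x y
    conclude E a y near (inj₁ free) = free
    conclude {T = T} {ρ} {x} E a y near (inj₂ far) = c , c-run , (begin
      dist T (ι a) (ι c) ⊕ dist S c y  ∼⟨ ⊕-monoˡ-≼ _ (embed-≼ embedding a c) ⟩
      dist S a c ⊕ dist S c y          ∼⟨ near ⟩
      ρ                                ∼⟨ far ⟩
      dist T x (ι y)                   ∎)
      where open Extension E

  -- Such a run has more steps than there are points, so its start is periodic, hence fixed, and by
  -- determinism it also ends there.
  long-run⇒Fix : ∀ S {g} → Per (act S g) ⊆ Fix (act S g) →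
    ∀ {x y} → Run S (replicate (suc (FiniteMetricSpace.size (space S))) g) x y → Fix (act S g) x × x ≡ y
  long-run⇒Fix S {g} Per⊆Fix {x} run = fix , run-deterministic (fixed-run _) run
    where
    fix : Fix (act S g) x
    fix = Per⊆Fix (long-orbit⇒Per (act S g) (ℕ.n≤1+n _) (run-replicate _ run))
    fixed-run : ∀ n → Run S (replicate n g) x x
    fixed-run zero    = []
    fixed-run (suc n) = fix ∷ fixed-run n

-- Positive words in the free group

positive : Generator → Letter
positive g = g , Sign.+

-- An inverse of a positive letter is negative, so nothing cancels. With positive words the product
-- of the power of `t` and `v` is reduced whatever `v` begins with.
positive-reduced : ∀ w → Reduced (map positive w)
positive-reduced []          = []
positive-reduced (g ∷ [])    = [-]
positive-reduced (g ∷ h ∷ w) = (λ ()) ∷ positive-reduced (h ∷ w)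

module _ {S : System} where

  -- Matching on the generator lets `assign` compute.
  Run⇒Maps : ∀ {w x y} → Run S w x y → Maps (act S s) (act S t) (map positive w) x y
  Run⇒Maps []                   = []
  Run⇒Maps (_∷_ {s} step run) = step ∷ Run⇒Maps run
  Run⇒Maps (_∷_ {t} step run) = step ∷ Run⇒Maps run

  Maps⇒Run : ∀ w {x y} → Maps (act S s) (act S t) (map positive w) x y → Run S w x y
  Maps⇒Run []      []           = []
  Maps⇒Run (s ∷ w) (step ∷ run) = step ∷ Maps⇒Run w run
  Maps⇒Run (t ∷ w) (step ∷ run) = step ∷ Maps⇒Run w run

concat-replicate-replicate : ∀ {A : Set} m n (x : A) →
  concat (replicate m (replicate n x)) ≡ replicate (m ℕ.* n) x
concat-replicate-replicate zero    n x = refl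
concat-replicate-replicate (suc m) n x =
  trans (cong (replicate n x ++_) (concat-replicate-replicate m n x)) (++-replicate n)
  where
  ++-replicate : ∀ n {l} → replicate n x ++ replicate l x ≡ replicate (n ℕ.+ l) x
  ++-replicate zero    = refl
  ++-replicate (suc n) = cong (x ∷_) (++-replicate n)

-- Construction of the word and the free amalgam

word-defined-everywhere : ExcludedMiddle 0ℓ → ∀ {G : Generator → Set} S → CommonFixedPoint S →
  ∀ {w} → All G w → ∀ {X : Set} {n} → X ↔ Fin n → (x : X → Point S) →
  Σ[ T ∈ System ] Σ[ E ∈ Extension G S T ] (∀ i → ∃[ y ] Run T w (Extension.ι E (x i)) y)
word-defined-everywhere em S fixed {w} Gw X↔Fin x =
  let T , E , runs = word-defined-on em S fixed Gw (x ∘ from)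
  in T , E , λ i → subst (λ j → ∃[ y ] Run T w (Extension.ι E (x j)) y) (from-index i) (runs (index i))
  where open Inverse X↔Fin using (from) renaming (to to index; strictlyInverseʳ to from-index)

widen : ∀ {G S T} → Extension G S T → Extension (λ _ → ⊤) S T
widen E = record
  { embedding = embedding ; extends = extends ; periodic = periodic ; semigroup = semigroup
  ; free = free ; inactive = λ g ¬⊤ → contradiction tt ¬⊤ }
  where open Extension E

PerFix : System → Set
PerFix S = ∀ g → Per (act S g) ⊆ Fix (act S g)

PerFix-extension : ∀ {G S T} → Extension G S T → PerFix S → PerFix T
PerFix-extension E per⊆fix g per with x , per , refl ← Extension.periodic E g per =
  Extension.extends E g x x (per⊆fix g per)

Per-extension : ∀ {G S T} (E : Extension G S T) → PerFix S → ∀ g →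
  Per (act T g) ≐ image (Extension.ι E) (Per (act S g))
Per-extension {T = T} E per⊆fix g = Extension.periodic E g ,
  λ { (x , per , refl) → Fix⇒Per (act T g) (Extension.extends E g x x (per⊆fix g per)) }

fixing-word : ℕ → List Generator
fixing-word n = replicate n t ++ replicate n s

-- The block of `s` acts first and forces its start to be fixed by `s`; the block of `t` therefore
-- begins at the same point and forces it to be fixed by `t` as well.
run-rigid : ∀ S → PerFix S → ∀ {x y} →
  Run S (fixing-word (suc (FiniteMetricSpace.size (space S)))) x y → (∀ g → Fix (act S g) x) × x ≡ y
run-rigid S per⊆fix run
  with y , s-run , t-run ← run-split (replicate (suc (FiniteMetricSpace.size (space S))) t) run
  with s-fix , refl ← long-run⇒Fix S (per⊆fix s) s-run
  with t-fix , refl ← long-run⇒Fix S (per⊆fix t) t-run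
  = (λ { s → s-fix ; t → t-fix }) , refl

FreeAlong : ∀ {G S T} → Extension G S T → Pred (Point S) 0ℓ → List Generator → Set
FreeAlong {S = S} {T} E Z w = ∀ a {x} → Run T w (ι a) x → ∀ y →
  ∃[ z ] (Z z × dist T (ι a) (ι z) ⊕ dist S z y ≼ dist T x (ι y))
  where open Extension E

module _ (em : ExcludedMiddle 0ℓ) (S : System) (fixed : CommonFixedPoint S) (per⊆fix : PerFix S) where

  free-word : Σ[ T ∈ System ] Σ[ E ∈ Extension (λ _ → ⊤) S T ] Σ[ v ∈ List Generator ]
    ((∀ a → ∃[ x ] Run T v (Extension.ι E a) x) × FreeAlong E (λ z → ∀ g → Fix (act S g) z) v)
  free-word =
    let w = fixing-word (suc (FiniteMetricSpace.size (space S)))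
        n , free = power-free em S (run-fixed w (proj₂ fixed)) (λ run → proj₂ (run-rigid S per⊆fix run))
        v = concat (replicate (suc n) w)
        T , E , runs = word-defined-everywhere em S fixed (universal (λ _ → tt) v)
                         (FiniteMetricSpace.finite (space S)) (λ a → a)
    in T , E , v , runs , λ a run y →
       let z , z-run , path = free E a run y in z , proj₁ (run-rigid S per⊆fix z-run) , path

  -- Restricting the extension to `t` leaves the domain of the map of `s` as it was; the price is
  -- that the paths pass through points fixed by `t` alone.
  free-t-power : ∀ {X : Set} {m} → X ↔ Fin m → (x : X → Point S) →
    Σ[ T ∈ System ] Σ[ E ∈ Extension (_≡ t) S T ] ∃[ k ]
    ((∀ i → ∃[ y ] Run T (replicate (suc k) t) (Extension.ι E (x i)) y) ×
     FreeAlong E (Fix (act S t)) (replicate (suc k) t))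
  free-t-power X↔Fin x =
    let N = suc (FiniteMetricSpace.size (space S))
        rigid = long-run⇒Fix S (per⊆fix t)
        n , free = power-free em S (run-fixed (replicate N t) (proj₂ fixed)) (λ run → proj₂ (rigid run))
        -- Both factors of `suc n ℕ.* N` are successors, so the product reduces to a successor; its
        -- predecessor is the exponent left to inference below.
        T , E , runs = word-defined-everywhere em S fixed (replicate⁺ (suc n ℕ.* N) refl) X↔Fin x
    in T , E , _ , runs , λ a {x} run y →
       let run′ = subst (λ w → Run T w (Extension.ι E a) x) (sym (concat-replicate-replicate (suc n) N t)) run
           z , z-run , path = free E a run′ y
       in z , proj₁ (rigid z-run) , path

free-amalgam : ∀ {S₀ S₁ S₂} (E₁ : Extension (λ _ → ⊤) S₀ S₁) (E₂ : Extension (_≡ t) S₁ S₂) {v k} →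
  (∀ a → ∃[ x ] Run S₁ v (Extension.ι E₁ a) x) →
  FreeAlong E₁ (λ z → ∀ g → Fix (act S₀ g) z) v →
  FreeAlong E₂ (Fix (act S₁ t)) (replicate k t) →
  ∀ a {x} → Run S₂ (replicate k t ++ v) (Extension.ι E₂ (Extension.ι E₁ a)) x →
  ∀ {y} → Dom (act S₂ s) y →
  ∃[ z ] ((∀ g → Fix (act S₀ g) z) ×
    let z₂ = Extension.ι E₂ (Extension.ι E₁ z) in dist S₂ x z₂ ⊕ dist S₂ z₂ y ≼ dist S₂ x y)
free-amalgam {S₀} {S₁} {S₂} E₁ E₂ {v} {k} runs free₁ free₂ a {x} run y-dom
  -- The last stage added no edges of `s`, so y comes from S₁, where `free₂` applies.
  with y , _ , refl ← Extension.inactive E₂ s (λ ()) y-dom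
  with x₁ , run₁ ← runs a
  with x₂ , v-run , t-run ← run-split (replicate k t) run
  with refl ← run-deterministic (run-extend E₂ run₁) v-run
  with z₁ , z₁-fix , z₁-path ← free₂ x₁ t-run y
  -- The point z₁ is only known to be fixed by `t` in S₁. Since no periodic points were added, it
  -- comes from S₀, and `free₁` can route the path to it through a common fixed point.
  with b , _ , refl ← Extension.periodic E₁ t (Fix⇒Per (act S₁ t) z₁-fix)
  with z , z-fix , z-path ← free₁ a run₁ b
  = z , z-fix , (begin
    dist S₂ x (ι₂ (ι₁ z)) ⊕ dist S₂ (ι₂ (ι₁ z)) (ι₂ y)
      -- The whole word fixes z, so the distance from x to z is the distance from the starting point
      -- a to z.
      ∼⟨ ⊕-mono-≼ (run-isometric′ run (run-fixed _ λ g →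
           Extension.extends E₂ g _ _ (Extension.extends E₁ g z z (z-fix g))))
                  (embed-≼ (Extension.embedding E₂) (ι₁ z) y) ⟩
    dist S₂ (ι₂ (ι₁ a)) (ι₂ (ι₁ z)) ⊕ dist S₁ (ι₁ z) y
      ∼⟨ ⊕-mono-≼ (embed-≼ (Extension.embedding E₂) (ι₁ a) (ι₁ z))
                  (d-triangle-≼ (space S₁) (ι₁ z) (ι₁ b) y) ⟩
    dist S₁ (ι₁ a) (ι₁ z) ⊕ (dist S₁ (ι₁ z) (ι₁ b) ⊕ dist S₁ (ι₁ b) y)
      ∼⟨ ⊕-monoʳ-≼ _ (⊕-monoˡ-≼ _ (embed-≼ (Extension.embedding E₁) z b)) ⟩
    dist S₁ (ι₁ a) (ι₁ z) ⊕ (dist S₀ z b ⊕ dist S₁ (ι₁ b) y)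
      ∼⟨ ⊕-assoc-≽ _ _ _ ⟩
    dist S₁ (ι₁ a) (ι₁ z) ⊕ dist S₀ z b ⊕ dist S₁ (ι₁ b) y
      ∼⟨ ⊕-monoˡ-≼ _ z-path ⟩
    dist S₁ x₁ (ι₁ b) ⊕ dist S₁ (ι₁ b) y
      ∼⟨ ⊕-monoˡ-≼ _ (embed-≽ (Extension.embedding E₂) x₁ (ι₁ b)) ⟩
    dist S₂ (ι₂ x₁) (ι₂ (ι₁ b)) ⊕ dist S₁ (ι₁ b) y
      ∼⟨ z₁-path ⟩
    dist S₂ x (ι₂ y) ∎)
  where
  open Extension E₁ using () renaming (ι to ι₁)
  open Extension E₂ using () renaming (ι to ι₂)

word-positive : ∀ k v → map positive (replicate k t ++ v) ≡ (t ^ (ℤ.+ k)) ++ map positive v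
word-positive k v =
  trans (map-++ positive (replicate k t) v) (cong (_++ map positive v) (map-replicate positive k t))

module _ {S : System} {k : ℕ} {v : List Generator} {x y : Point S} where

  t-power-Run⇒Maps : Run S (replicate k t ++ v) x y →
    Maps (act S s) (act S t) ((t ^ (ℤ.+ k)) ++ map positive v) x y
  t-power-Run⇒Maps run =
    subst (λ w → Maps (act S s) (act S t) w x y) (word-positive k v) (Run⇒Maps run)

  t-power-Maps⇒Run : Maps (act S s) (act S t) ((t ^ (ℤ.+ k)) ++ map positive v) x y →
    Run S (replicate k t ++ v) x y
  t-power-Maps⇒Run maps =
    Maps⇒Run _ (subst (λ w → Maps (act S s) (act S t) w x y) (sym (word-positive k v)) maps)

-- The triangle inequality already bounds d(x, y) by every path through Z, so a single path that is
-- no longer than d(x, y) attains the minimum.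
IsFreeAmalgamOver-intro : ∀ (M : FiniteMetricSpace) {Z Y X : Pred (Carrier M) 0ℓ} →
  (∀ {x y} → X x → Y y → ∃[ z ] (Z z × d M x z ⊕ d M z y ≼ d M x y)) →
  IsFreeAmalgamOver M Z Y X
IsFreeAmalgamOver-intro M path x y Xx Yy =
  let z , Zz , short = path Xx Yy
  in (d M x z + d M z y , (z , Zz , refl) ,
      ≼-⊕⇒≈-+ {d M x y} {d M x z} {d M z y} (d-triangle-≼ M x z y) short)
   , λ { _ (v , _ , refl) → FiniteMetricSpace.d-triangle M x v y }

module _ (em : ExcludedMiddle 0ℓ) (S : System) (fixed : CommonFixedPoint S) (per⊆fix : PerFix S) where

  opaque
    amalgam-extension : Σ[ T ∈ System ] Σ[ E ∈ Extension (λ _ → ⊤) S T ] ∃[ k ] ∃[ v ]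
      ((∀ a → ∃[ x ] Run T (replicate (suc k) t ++ v) (Extension.ι E a) x) ×
       (∀ a {x} → Run T (replicate (suc k) t ++ v) (Extension.ι E a) x → ∀ {y} → Dom (act T s) y →
         ∃[ z ] ((∀ g → Fix (act S g) z) ×
           dist T x (Extension.ι E z) ⊕ dist T (Extension.ι E z) y ≼ dist T x y)))
    amalgam-extension
      with S₁ , E₁ , v , runs₁ , free₁ ← free-word em S fixed per⊆fix
      with S₂ , E₂ , k , runs₂ , free₂ ← free-t-power em S₁ (fixed⁺ E₁ fixed) (PerFix-extension E₁ per⊆fix)
                                           (FiniteMetricSpace.finite (space S)) (λ a → proj₁ (runs₁ a))
      = S₂ , trans-extension E₁ (widen E₂) , k , v
      , (λ a → proj₁ (runs₂ a) , run-join (proj₂ (runs₂ a)) (run-extend E₂ (proj₂ (runs₁ a))))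
      , free-amalgam E₁ E₂ runs₁ free₁ free₂

theorem4p13 :
    ExcludedMiddle 0ℓ →
    (A : FiniteMetricSpace) (p q : PartialIsometry A) →
    Per p ≐ Fix p →
    Per q ≐ Fix q →
    Satisfiable (Fix p ∩ Fix q) →
    Σ[ B ∈ FiniteMetricSpace ] Σ[ ι ∈ A ↪ B ]
    Σ[ p̄ ∈ PartialIsometry B ] Σ[ q̄ ∈ PartialIsometry B ]
    Σ[ K ∈ ℤ ] Σ[ v ∈ Word ]
      let w    = (t ^ K) ++ v
          A⊆B  = image (to ι) U
          w[A] = WordImage p̄ q̄ w A⊆B
      in
        Extends ι p̄ p
      × Extends ι q̄ q
      × K ≢ 0ℤ
      × Reduced w
      × Per p̄ ≐ image (to ι) (Per p)
      × Per q̄ ≐ image (to ι) (Per q)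
      × (∀ a → ∃[ x ] Maps p̄ q̄ w (to ι a) x)
      × IsFreeAmalgamOver B (image (to ι) (Fix p ∩ Fix q)) (Dom p̄) w[A]
      × (∀ x y → AdditiveSemigroup (Distances A) (FiniteMetricSpace.d B x y))
      × ((Σ[ a ∈ Carrier A ] Σ[ b ∈ Carrier A ] a ≢ b) →
         ∃[ r ] (IsDen A U r × IsDen B (Dom p̄ ∪ A⊆B) r × IsDen B (Dom q̄ ∪ A⊆B) r))
theorem4p13 em A p q Per-p≐Fix-p Per-q≐Fix-q (c , c-fix-p , c-fix-q) =
  let per⊆fix : PerFix (system A (assign p q))
      per⊆fix = λ { s → proj₁ Per-p≐Fix-p ; t → proj₁ Per-q≐Fix-q }
      T , E , k , v , runs , path = amalgam-extension em (system A (assign p q))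
        (c , λ { s → c-fix-p ; t → c-fix-q }) per⊆fix
  in space T , Extension.embedding E , act T s , act T t , ℤ.+ suc k , map positive v
  , Extension.extends E s
  , Extension.extends E t
  , (λ ())
  , subst Reduced (word-positive (suc k) v) (positive-reduced (replicate (suc k) t ++ v))
  , Per-extension E per⊆fix s
  , Per-extension E per⊆fix t
  , (λ a → let x , run = runs a in
           x , t-power-Run⇒Maps {T} {suc k} {v} run)
  , IsFreeAmalgamOver-intro (space T) (λ { (_ , (a , _ , refl) , maps) y-dom →
      let z , z-fix , short = path a (t-power-Maps⇒Run {T} {suc k} {v} maps) y-dom
      in Extension.ι E z , (z , (z-fix s , z-fix t) , refl) , short })
  , Extension.semigroup E
  , λ distinct →
      let a , b , a≢b , least = closest-pair em A distinct
          id = refl-extension {λ _ → ⊤} (system A (assign p q))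
      in d A a b
       , IsDen-extension em A (Extension.embedding id) (Extension.semigroup id) a≢b least (λ _ → tt)
       , IsDen-extension em A (Extension.embedding E) (Extension.semigroup E) a≢b least inj₂
       , IsDen-extension em A (Extension.embedding E) (Extension.semigroup E) a≢b least inj₂
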